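{- For an integer $n \ge 3$, let $N := \lfloor \log_2 \log_5 n \rfloor + 1$ and \[ g(n) := n^2 - \left(\sum_{j=1}^N \frac{n^{1 + \frac{1}{2^j}}}{2^{j-1}} \right) + \left(2 - \frac{1}{2^{N-1}}\right)n. \] Then for all integers $n \ge 3$, $|b(n) - g(n)| < 2n$.
   Context: A reachable pair of a digraph $\Gamma$ is an ordered pair $(\alpha,\beta)$ of (not necessarily distinct) vertices such that there is a directed path (possibly of length $0$) from $\alpha$ to $\beta$; the weight $w(\Gamma)$ is the number of reachable pairs. For $n\in\mathbb{N}$, $W(n)$ is the set of all integers $k$ such that some digraph on $n$ vertices has weight $k$. For $n \in \mathbb{N}$, $b(n)$ is the largest integer such that every integer $k$ with $n \le k \le b(n)$ lies in $W(n)$. -}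

module Defs where

open import Data.Nat as ℕ using (ℕ; zero; suc; _≤_; _<_)
open import Data.Bool using (Bool; true)
open import Data.Fin using (Fin)
open import Data.Product using (Σ; _×_; _,_; ∃)
open import Data.List using (List; length)
open import Data.List.Membership.Propositional using (_∈_)
open import Data.List.Relation.Unary.Unique.Propositional using (Unique)
open import Relation.Binary.PropositionalEquality using (_≡_)
open import Relation.Binary.Construct.Closure.ReflexiveTransitive using (Star)
open import Relation.Nullary using (¬_)
open import Function.Bundles using (_⇔_)
open import Data.Integer using (+_)
open import Data.Rational as ℚ using (ℚ; _/_; 0ℚ; 1ℚ)

-- Digraphs on n vertices: an adjacency relation on Fin n (loops allowed,
-- they do not affect reachability).

Digraph : ℕ → Set
Digraph n = Fin n → Fin n → Bool

Edge : ∀ {n} → Digraph n → Fin n → Fin n → Set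
Edge Γ α β = Γ α β ≡ true

Reach : ∀ {n} → Digraph n → Fin n → Fin n → Set
Reach Γ = Star (Edge Γ)

HasWeight : ∀ {n} → Digraph n → ℕ → Set
HasWeight {n} Γ k =
  Σ (List (Fin n × Fin n)) λ L →
    Unique L × (∀ α β → ((α , β) ∈ L) ⇔ Reach Γ α β) × length L ≡ k

InW : ℕ → ℕ → Set
InW n k = Σ (Digraph n) λ Γ → HasWeight Γ k

IsB : ℕ → ℕ → Set
IsB n b = (∀ k → n ≤ k → k ≤ b → InW n k) × ¬ (∀ k → n ≤ k → k ≤ suc b → InW n k)

-- N = ⌊ log₂ log₅ n ⌋ + 1  (for n ≥ 3).
-- ⌊ log₂ log₅ n ⌋ = m  ⇔  2^m ≤ log₅ n < 2^(m+1)  ⇔  5^(2^m) ≤ n < 5^(2^(m+1)),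
-- for integer m (including m = -1, where 5^(2^-1) = √5 ≤ n < 5, i.e. 3 ≤ n < 5
-- given n ≥ 3). So N = 0 iff n < 5 and N = suc m iff 5^(2^m) ≤ n < 5^(2^(suc m)).
IsN : ℕ → ℕ → Set
IsN n zero    = n < 5
IsN n (suc m) = 5 ℕ.^ (2 ℕ.^ m) ≤ n × n < 5 ℕ.^ (2 ℕ.^ suc m)

infixr 8 _^ᵠ_
_^ᵠ_ : ℚ → ℕ → ℚ
x ^ᵠ zero  = 1ℚ
x ^ᵠ suc k = x ℚ.* (x ^ᵠ k)

fromℕ : ℕ → ℚ
fromℕ k = (+ k) / 1

half^ : ℕ → ℚ
half^ k = ((+ 1) / 2) ^ᵠ k

sum1to : ℕ → (ℕ → ℚ) → ℚ
sum1to zero    f = 0ℚ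
sum1to (suc N) f = sum1to N f ℚ.+ f (suc N)

-- x is a rational with x ≥ n^(1 + 1/2^j)   (x ≥ 0 and x^(2^j) ≥ n^(2^j + 1))
AboveRoot : ℕ → ℕ → ℚ → Set
AboveRoot n j x = 0ℚ ℚ.≤ x × fromℕ (n ℕ.^ (2 ℕ.^ j ℕ.+ 1)) ℚ.≤ x ^ᵠ (2 ℕ.^ j)

-- x is a rational with 0 ≤ x ≤ n^(1 + 1/2^j)
BelowRoot : ℕ → ℕ → ℚ → Set
BelowRoot n j x = 0ℚ ℚ.≤ x × x ^ᵠ (2 ℕ.^ j) ℚ.≤ fromℕ (n ℕ.^ (2 ℕ.^ j ℕ.+ 1))

-- S(n,N) := Σ_{j=1}^{N} n^(1 + 1/2^j) / 2^(j-1)  is a real number; we express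
-- the strict comparisons q < S and S < q (for rational q) exactly, by rational
-- approximations of the algebraic numbers n^(1+1/2^j) from below / above.
SumLT : ℕ → ℕ → ℚ → Set
SumLT n N q = Σ (ℕ → ℚ) λ r → (∀ j → AboveRoot n j (r j)) ×
  sum1to N (λ j → r j ℚ.* half^ (j ℕ.∸ 1)) ℚ.< q

SumGT : ℕ → ℕ → ℚ → Set
SumGT n N q = Σ (ℕ → ℚ) λ s → (∀ j → BelowRoot n j (s j)) ×
  q ℚ.< sum1to N (λ j → s j ℚ.* half^ (j ℕ.∸ 1))

-- g(n) = n² − S(n,N) + (2 − 1/2^(N−1)) n   where 1/2^(N-1) = 2 · (1/2^N)
-- (N may be 0, in which case 2 − 1/2^(−1) = 0).
-- gRest n N = n² + (2 − 2/2^N) n, so g = gRest − S.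
gRest : ℕ → ℕ → ℚ
gRest n N = fromℕ (n ℕ.* n) ℚ.+ (fromℕ 2 ℚ.- fromℕ 2 ℚ.* half^ N) ℚ.* fromℕ n

-- |b − g(n)| < 2n  ⇔  b − 2n < gRest − S < b + 2n
--                  ⇔  gRest − b − 2n < S < gRest − b + 2n
AbsDiffLt2n : ℕ → ℕ → ℕ → Set
AbsDiffLt2n n N b =
  SumGT n N (gRest n N ℚ.- fromℕ b ℚ.- fromℕ (2 ℕ.* n)) ×
  SumLT n N (gRest n N ℚ.- fromℕ b ℚ.+ fromℕ (2 ℕ.* n))

{-# OPTIONS --safe #-}

-- W(n) is the set of weights of preorders on n points.
--
-- Adding a class of n - j mutually reachable points on top of a preorder on j points gives
-- (n - j) n + w ∈ W(n) for w ∈ W(j).  Conversely, if w ∉ W(j) with w < n and j of order √n, then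
-- (n - j) n + w ∉ W(n): by averaging some point has in- and outdegree summing to more than 2(n - j),
-- so its class is large, and deleting points of that class one at a time would leave a preorder on j
-- points of weight w, unless the weight left is out of range.
-- Choosing j as large as possible at each step gives sequences with [n, lower n] ⊆ W(n) and
-- upper n ∉ W(n), both of the form v(n) = (n - j) n + v(j) with v(j) close to n.
--
-- With Q₀ = 2 and Q_{N+1}(z) = √z + Q_N(√z)/2 one has g(n) = n² + 2n - n Q_N(n), and since
-- v(j) ≈ j² - j Q(j) ≈ n amounts to j ≈ √n + Q(j)/2, the recursion for v is that for Q up to an
-- error which is halved at each step.
module Submission where

open import Defs

-- The two sequences differ in the rule that fixes j: `upper j < n` is what the gap argument needs,
-- while for `lower` consecutive blocks of weights have to touch. After cancelling n², both bounds
-- compare j with Q_N(n). For `upper` it suffices that Q_N(n) ≤ j + 3, because upper j < n. For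
-- `lower` it suffices that j + (j + 2)/n < Q_N(n) + 1, because lower j ≥ n - j - 2. The second has
-- little room: one step of the recursion is shown to lose at most 39/40 of the available 1, and
-- this estimate starts at j = 400. Smaller indices are settled by numerical certificates that the
-- type checker evaluates. As g(n) is a real number, Q_N itself is never formed: every root is
-- replaced by a rational bound, which makes each estimate a polynomial identity with nonnegative
-- terms.

module Preorders where

  open import Data.Nat
  open import Data.Nat.Properties
  open import Data.Nat.Solver using (module +-*-Solver)
  open import Data.Bool using (Bool; true; false; _∧_; not; if_then_else_)
  import Data.Bool.Properties as Bool
  open import Data.Empty using (⊥)
  open import Data.Fin using (Fin; zero; suc; punchIn; punchOut; splitAt; _↑ˡ_; _↑ʳ_)
  import Data.Fin.Properties as Fin
  open import Data.Product
  import Data.Product.Properties as Prod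
  open import Data.Sum using (_⊎_; inj₁; inj₂)
  open import Data.List as List using (List; length; filter; cartesianProduct; allFin; tabulate; _++_)
  import Data.List.Properties as List
  open import Data.List.Membership.Propositional using (_∈_)
  open import Data.List.Membership.Propositional.Properties
  open import Data.List.Membership.DecPropositional using () renaming (_∈?_ to mem?)
  import Data.List.Membership.Setoid.Properties as SetoidMem
  open import Data.List.Relation.Unary.Unique.Propositional using (Unique)
  import Data.List.Relation.Unary.Unique.Propositional.Properties as Unique
  open import Data.List.Relation.Binary.BagAndSetEquality using (∼bag⇒↭)
  open import Data.List.Relation.Binary.Permutation.Propositional.Properties using (↭-length)
  open import Relation.Binary.PropositionalEquality
  open import Relation.Binary.Construct.Closure.ReflexiveTransitive using (ε; _◅_; _◅◅_)
  open import Relation.Binary.Definitions using (tri<; tri≈; tri>)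
  open import Relation.Nullary
  open import Relation.Nullary.Decidable using (does; dec-true)
  open import Axiom.UniquenessOfIdentityProofs using (module Decidable⇒UIP)
  open import Function using (_∘_; mk⇔; mk↔ₛ′; Equivalence; _⇔_)
  open import Algebra.Properties.CommutativeMonoid.Sum +-0-commutativeMonoid
    using (sum; sum-remove; ∑-distrib-+; ∑-comm; sum-cong-≗)
  open +-*-Solver using (solve; _:=_; _:+_; _:*_; con)

  -- Weights of digraphs as weights of preorders.

  ⟦_⟧ : Bool → ℕ
  ⟦ b ⟧ = if b then 1 else 0

  record Preorder (n : ℕ) : Set where
    field
      rel   : Fin n → Fin n → Bool
      refl′  : ∀ x → rel x x ≡ true
      trans′ : ∀ {x y z} → rel x y ≡ true → rel y z ≡ true → rel x z ≡ true

  open Preorder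

  weight : ∀ {n} → Preorder n → ℕ
  weight R = sum λ x → sum λ y → ⟦ rel R x y ⟧

  -- Membership in a duplicate-free list is a proposition, so equivalent membership is already a
  -- bijection of membership proofs, that is bag equality, which gives a permutation.
  unique⇒same-length : ∀ {n} {xs ys : List (Fin n × Fin n)} → Unique xs → Unique ys →
    (∀ z → z ∈ xs ⇔ z ∈ ys) → length xs ≡ length ys
  unique⇒same-length {n} ux uy iff = ↭-length (∼bag⇒↭ (λ {z} →
    mk↔ₛ′ (Equivalence.to (iff z)) (Equivalence.from (iff z))
      (λ _ → irrelevant uy _ _) (λ _ → irrelevant ux _ _)))
    where
    irrelevant : ∀ {zs} → Unique zs → ∀ {z} → (p q : z ∈ zs) → p ≡ q
    irrelevant u = SetoidMem.unique⇒irrelevant (setoid _)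
      (Decidable⇒UIP.≡-irrelevant (Prod.≡-dec Fin._≟_ Fin._≟_)) u

  length-filter-tabulate : ∀ {a} {A : Set a} {n} (p : A → Bool) (f : Fin n → A) →
    length (filter (λ x → p x Bool.≟ true) (tabulate f)) ≡ sum (⟦_⟧ ∘ p ∘ f)
  length-filter-tabulate {n = zero}  p f = refl
  length-filter-tabulate {n = suc n} p f with p (f zero)
  ... | true  = cong suc (length-filter-tabulate p (f ∘ suc))
  ... | false = length-filter-tabulate p (f ∘ suc)

  pairs : ∀ {n} → Preorder n → List (Fin n × Fin n)
  pairs {n} R = filter (λ z → rel R (proj₁ z) (proj₂ z) Bool.≟ true) (cartesianProduct (allFin n) (allFin n))

  length-pairs : ∀ {n} (R : Preorder n) → length (pairs R) ≡ weight R
  length-pairs {n} R = go (λ i → i)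
    where
    p : Fin n × Fin n → Bool
    p z = rel R (proj₁ z) (proj₂ z)
    go : ∀ {m} (f : Fin m → Fin n) →
      length (filter (λ z → p z Bool.≟ true) (cartesianProduct (tabulate f) (allFin n)))
        ≡ sum λ i → sum λ y → ⟦ rel R (f i) y ⟧
    go {zero}  f = refl
    go {suc m} f = begin
      length (keep (row ++ rest))              ≡⟨ cong length (List.filter-++ _ row rest) ⟩
      length (keep row ++ keep rest)           ≡⟨ List.length-++ (keep row) ⟩
      length (keep row) + length (keep rest)   ≡⟨ cong (λ zs → length (keep zs) + length (keep rest))
                                                    (List.map-tabulate {n = n} (λ y → y) (f zero ,_)) ⟩
      length (keep (tabulate (f zero ,_))) + length (keep rest)
                                               ≡⟨ cong₂ _+_ (length-filter-tabulate p (f zero ,_)) (go (f ∘ suc)) ⟩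
      sum (λ y → ⟦ rel R (f zero) y ⟧) + sum (λ i → sum λ y → ⟦ rel R (f (suc i)) y ⟧) ∎
      where
      open ≡-Reasoning
      keep : List (Fin n × Fin n) → List (Fin n × Fin n)
      keep = filter (λ z → p z Bool.≟ true)
      row rest : List (Fin n × Fin n)
      row = List.map (f zero ,_) (allFin n)
      rest = cartesianProduct (tabulate (f ∘ suc)) (allFin n)

  ∈-pairs : ∀ {n} (R : Preorder n) {x y} → (x , y) ∈ pairs R ⇔ rel R x y ≡ true
  ∈-pairs {n} R = mk⇔
    (λ m → proj₂ (∈-filter⁻ (λ z → rel R (proj₁ z) (proj₂ z) Bool.≟ true) {xs = cartesianProduct (allFin n) (allFin n)} m))
    (λ r → ∈-filter⁺ (λ z → rel R (proj₁ z) (proj₂ z) Bool.≟ true) (∈-cartesianProduct⁺ (∈-allFin _) (∈-allFin _)) r)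

  unique-pairs : ∀ {n} (R : Preorder n) → Unique (pairs R)
  unique-pairs {n} R = Unique.filter⁺ _ (Unique.cartesianProduct⁺ (Unique.allFin⁺ n) (Unique.allFin⁺ n))

  weight∈W : ∀ {n} (R : Preorder n) → InW n (weight R)
  weight∈W R = rel R , pairs R , unique-pairs R , (λ α β → mk⇔ (from ∘ to-rel) (to-mem ∘ collapse)) , length-pairs R
    where
    to-rel : ∀ {α β} → (α , β) ∈ pairs R → rel R α β ≡ true
    to-rel = Equivalence.to (∈-pairs R)
    to-mem : ∀ {α β} → rel R α β ≡ true → (α , β) ∈ pairs R
    to-mem = Equivalence.from (∈-pairs R)
    from : ∀ {α β} → rel R α β ≡ true → Reach (rel R) α β
    from e = e ◅ ε
    collapse : ∀ {α β} → Reach (rel R) α β → rel R α β ≡ true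
    collapse ε       = refl′ R _
    collapse (e ◅ s) = trans′ R e (collapse s)

  -- The list that witnesses the weight enumerates the reachable pairs, so membership in it decides
  -- reachability and turns it into a Boolean preorder.
  W⇒weight : ∀ {n k} → InW n k → Σ (Preorder n) λ R → weight R ≡ k
  W⇒weight {n} (Γ , L , uL , iff , refl) = R , trans (sym (length-pairs R)) (unique⇒same-length (unique-pairs R) uL same)
    where
    dec : ∀ α β → Dec ((α , β) ∈ L)
    dec α β = mem? (Prod.≡-dec Fin._≟_ Fin._≟_) (α , β) L
    sound : ∀ {α β} → does (dec α β) ≡ true → Reach Γ α β
    sound {α} {β} e with dec α β
    ... | yes m = Equivalence.to (iff α β) m
    complete : ∀ {α β} → Reach Γ α β → does (dec α β) ≡ true
    complete {α} {β} s = dec-true (dec α β) (Equivalence.from (iff α β) s)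
    R : Preorder n
    R = record
      { rel = λ α β → does (dec α β)
      ; refl′ = λ x → complete ε
      ; trans′ = λ e f → complete (sound e ◅◅ sound f)
      }
    same : ∀ z → z ∈ pairs R ⇔ z ∈ L
    same (α , β) = mk⇔
      (λ m → Equivalence.from (iff α β) (sound (Equivalence.to (∈-pairs R) m)))
      (λ m → Equivalence.from (∈-pairs R) (complete (Equivalence.to (iff α β) m)))

  -- Finite sums and the range of the weight.

  sum-mono : ∀ {n} {f g : Fin n → ℕ} → (∀ i → f i ≤ g i) → sum f ≤ sum g
  sum-mono {zero}  h = z≤n
  sum-mono {suc n} h = +-mono-≤ (h zero) (sum-mono (h ∘ suc))

  sum-const : ∀ n c → sum {n} (λ _ → c) ≡ n * c
  sum-const zero    c = refl
  sum-const (suc n) c = cong (c +_) (sum-const n c)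

  sum-splitAt : ∀ m {n} (f : Fin (m + n) → ℕ) → sum f ≡ sum (f ∘ (_↑ˡ n)) + sum (f ∘ (m ↑ʳ_))
  sum-splitAt zero    f = refl
  sum-splitAt (suc m) f = trans (cong (f zero +_) (sum-splitAt m (f ∘ suc))) (sym (+-assoc (f zero) _ _))

  sum>⇒∃> : ∀ {n} (f : Fin n → ℕ) b → n * b < sum f → ∃ λ i → b < f i
  sum>⇒∃> {suc n} f b lt with b <? f zero
  ... | yes p = zero , p
  ... | no ¬p with i , q ← sum>⇒∃> (f ∘ suc) b (+-cancelˡ-< b _ _ (<-≤-trans lt (+-monoˡ-≤ _ (≮⇒≥ ¬p))))
      = suc i , q

  ⟦⟧≤1 : ∀ b → ⟦ b ⟧ ≤ 1
  ⟦⟧≤1 false = z≤n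
  ⟦⟧≤1 true  = ≤-refl

  ⟦⟧-pos : ∀ {b} → 0 < ⟦ b ⟧ → b ≡ true
  ⟦⟧-pos {true} _ = refl

  term≤sum : ∀ {n} (f : Fin n → ℕ) i → f i ≤ sum f
  term≤sum f zero    = m≤m+n _ _
  term≤sum f (suc i) = ≤-trans (term≤sum (f ∘ suc) i) (m≤n+m _ _)

  n≤weight : ∀ {n} (R : Preorder n) → n ≤ weight R
  n≤weight {n} R = subst (_≤ weight R) (trans (sum-const n 1) (*-identityʳ n))
    (sum-mono λ x → ≤-trans (≤-reflexive (cong ⟦_⟧ (sym (refl′ R x)))) (term≤sum (λ y → ⟦ rel R x y ⟧) x))

  weight≤n² : ∀ {n} (R : Preorder n) → weight R ≤ n * n
  weight≤n² {n} R = subst (weight R ≤_) (sum-const n n)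
    (sum-mono λ x → subst (sum (λ y → ⟦ rel R x y ⟧) ≤_) (trans (sum-const n 1) (*-identityʳ n))
      (sum-mono λ y → ⟦⟧≤1 (rel R x y)))

  -- Adjoining a class of mutually reachable points.

  adjoinClass : ∀ c {n} → Bool → Preorder n → Preorder (c + n)
  adjoinClass c {n} d R = record
    { rel = λ x y → ρ (splitAt c x) (splitAt c y)
    ; refl′ = λ x → ρ-refl (splitAt c x)
    ; trans′ = λ {x} {y} {z} → ρ-trans (splitAt c x) (splitAt c y) (splitAt c z)
    }
    where
    ρ : Fin c ⊎ Fin n → Fin c ⊎ Fin n → Bool
    ρ (inj₁ _) (inj₁ _) = true
    -- `d` decides whether the new class reaches every old point or none.
    ρ (inj₁ _) (inj₂ _) = d
    ρ (inj₂ _) (inj₁ _) = false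
    ρ (inj₂ x) (inj₂ y) = rel R x y
    ρ-refl : ∀ x → ρ x x ≡ true
    ρ-refl (inj₁ _) = refl
    ρ-refl (inj₂ x) = refl′ R x
    ρ-trans : ∀ x y z → ρ x y ≡ true → ρ y z ≡ true → ρ x z ≡ true
    ρ-trans (inj₁ _) (inj₁ _) (inj₁ _) p q = refl
    ρ-trans (inj₁ _) (inj₁ _) (inj₂ _) p q = q
    ρ-trans (inj₁ _) (inj₂ _) (inj₂ _) p q = p
    ρ-trans (inj₂ x) (inj₂ y) (inj₂ z) p q = trans′ R p q

  weight-adjoinClass : ∀ c {n} d (R : Preorder n) →
    weight (adjoinClass c d R) ≡ c * (c + n * ⟦ d ⟧) + weight R
  weight-adjoinClass c {n} d R = trans (sum-splitAt c _) (cong₂ _+_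
      (trans (sum-cong-≗ top) (sum-const c _)) (sum-cong-≗ bottom))
    where
    entry = λ x y → ⟦ rel (adjoinClass c d R) x y ⟧
    top : ∀ x → sum (entry (x ↑ˡ n)) ≡ c + n * ⟦ d ⟧
    top x = trans (sum-splitAt c _) (cong₂ _+_
      (trans (sum-cong-≗ λ y → entry-ll y) (trans (sum-const c 1) (*-identityʳ c)))
      (trans (sum-cong-≗ λ y → entry-lr y) (sum-const n ⟦ d ⟧)))
      where
      entry-ll : ∀ y → entry (x ↑ˡ n) (y ↑ˡ n) ≡ 1
      entry-ll y rewrite Fin.splitAt-↑ˡ c x n | Fin.splitAt-↑ˡ c y n = refl
      entry-lr : ∀ y → entry (x ↑ˡ n) (c ↑ʳ y) ≡ ⟦ d ⟧
      entry-lr y rewrite Fin.splitAt-↑ˡ c x n | Fin.splitAt-↑ʳ c n y = refl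
    bottom : ∀ x → sum (entry (c ↑ʳ x)) ≡ sum (λ y → ⟦ rel R x y ⟧)
    bottom x = trans (sum-splitAt c _) (cong₂ _+_
      (trans (sum-cong-≗ entry-rl) (trans (sum-const c 0) (*-zeroʳ c)))
      (sum-cong-≗ entry-rr))
      where
      entry-rl : ∀ y → entry (c ↑ʳ x) (y ↑ˡ n) ≡ 0
      entry-rl y rewrite Fin.splitAt-↑ʳ c n x | Fin.splitAt-↑ˡ c y n = refl
      entry-rr : ∀ y → entry (c ↑ʳ x) (c ↑ʳ y) ≡ ⟦ rel R x y ⟧
      entry-rr y rewrite Fin.splitAt-↑ʳ c n x | Fin.splitAt-↑ʳ c n y = refl

  W-dominate : ∀ {j w} c → InW j w → InW (c + j) (c * (c + j) + w)
  W-dominate {j} c i with R , refl ← W⇒weight i =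
    subst (InW (c + j)) (trans (weight-adjoinClass c true R) (cong (λ m → c * (c + m) + weight R) (*-identityʳ j)))
      (weight∈W (adjoinClass c true R))

  W-isolated : ∀ {j w} → InW j w → InW (suc j) (suc w)
  W-isolated {j} i with R , refl ← W⇒weight i =
    subst (InW (suc j)) (trans (weight-adjoinClass 1 false R) (cong (λ m → 1 * (1 + m) + weight R) (*-zeroʳ j)))
      (weight∈W (adjoinClass 1 false R))

  -- Degrees, classes and deletion of points.

  degree : ∀ {n} → Preorder n → Fin n → ℕ
  degree R v = sum (λ y → ⟦ rel R v y ⟧) + sum (λ x → ⟦ rel R x v ⟧)

  classSize : ∀ {n} → Preorder n → Fin n → ℕ
  classSize R v = sum λ x → ⟦ rel R v x ∧ rel R x v ⟧

  incomparable : ∀ {n} → Preorder n → Fin n → ℕ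
  incomparable R v = sum λ x → ⟦ not (rel R v x) ∧ not (rel R x v) ⟧

  -- Out- and in-neighbours together count the class of `v` twice and miss the points incomparable
  -- to `v`. A degree well above n therefore forces a large class.
  degree+incomparable : ∀ {n} (R : Preorder n) v → degree R v + incomparable R v ≡ n + classSize R v
  degree+incomparable {n} R v = begin
    degree R v + incomparable R v                 ≡⟨ cong (_+ incomparable R v) (∑-distrib-+ f g) ⟨
    sum (λ x → f x + g x) + incomparable R v      ≡⟨ ∑-distrib-+ (λ x → f x + g x) h ⟨
    sum (λ x → f x + g x + h x)                   ≡⟨ sum-cong-≗ (λ x → inclusion-exclusion (rel R v x) (rel R x v)) ⟩
    sum (λ x → 1 + k x)                           ≡⟨ ∑-distrib-+ (λ _ → 1) k ⟩
    sum {n} (λ _ → 1) + classSize R v             ≡⟨ cong (_+ classSize R v) (trans (sum-const n 1) (*-identityʳ n)) ⟩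
    n + classSize R v                             ∎
    where
    open ≡-Reasoning
    f g h k : Fin n → ℕ
    f x = ⟦ rel R v x ⟧
    g x = ⟦ rel R x v ⟧
    h x = ⟦ not (rel R v x) ∧ not (rel R x v) ⟧
    k x = ⟦ rel R v x ∧ rel R x v ⟧
    inclusion-exclusion : ∀ a b → ⟦ a ⟧ + ⟦ b ⟧ + ⟦ not a ∧ not b ⟧ ≡ 1 + ⟦ a ∧ b ⟧
    inclusion-exclusion false false = refl
    inclusion-exclusion false true  = refl
    inclusion-exclusion true  false = refl
    inclusion-exclusion true  true  = refl

  sum-degree : ∀ {n} (R : Preorder n) → sum (degree R) ≡ weight R + weight R
  sum-degree R = trans (∑-distrib-+ (λ v → sum λ y → ⟦ rel R v y ⟧) (λ v → sum λ x → ⟦ rel R x v ⟧))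
    (cong (weight R +_) (∑-comm (λ v x → ⟦ rel R x v ⟧)))

  delete : ∀ {n} → Preorder (suc n) → Fin (suc n) → Preorder n
  delete R v = record
    { rel = λ x y → rel R (punchIn v x) (punchIn v y)
    ; refl′ = λ x → refl′ R (punchIn v x)
    ; trans′ = trans′ R
    }

  -- The loop at `v` is a single pair but enters `degree R v` twice, hence the `suc`.
  weight-delete : ∀ {n} (R : Preorder (suc n)) v → weight (delete R v) + degree R v ≡ suc (weight R)
  weight-delete {n} R v = begin
    w + (row + sum col)                        ≡⟨ cong (λ c → w + (row + c)) (sum-remove {i = v} col) ⟩
    w + (row + (⟦ rel R v v ⟧ + col′))         ≡⟨ cong (λ b → w + (row + (⟦ b ⟧ + col′))) (refl′ R v) ⟩
    w + (row + suc col′)                       ≡⟨ cong (w +_) (+-suc row col′) ⟩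
    w + suc (row + col′)                       ≡⟨ +-suc w _ ⟩
    suc (w + (row + col′))                     ≡⟨ cong suc (+-comm w _) ⟩
    suc (row + col′ + w)                       ≡⟨ cong suc (+-assoc row col′ w) ⟩
    suc (row + (col′ + w))                     ≡⟨ cong (λ s → suc (row + s)) (∑-distrib-+ (col ∘ punchIn v) _) ⟨
    suc (row + sum (λ x → col (punchIn v x) + sum (λ y → ⟦ rel R (punchIn v x) (punchIn v y) ⟧)))
      ≡⟨ cong (λ s → suc (row + s)) (sum-cong-≗ λ x → sum-remove {i = v} (λ y → ⟦ rel R (punchIn v x) y ⟧)) ⟨
    suc (row + sum (λ x → sum λ y → ⟦ rel R (punchIn v x) y ⟧))
      ≡⟨ cong suc (sum-remove {i = v} (λ x → sum λ y → ⟦ rel R x y ⟧)) ⟨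
    suc (weight R)                             ∎
    where
    open ≡-Reasoning
    w = weight (delete R v)
    row = sum λ y → ⟦ rel R v y ⟧
    col : Fin (suc n) → ℕ
    col x = ⟦ rel R x v ⟧
    col′ = sum (col ∘ punchIn v)

  ≡true-ext : ∀ {a b} → (a ≡ true → b ≡ true) → (b ≡ true → a ≡ true) → a ≡ b
  ≡true-ext {true}          f g = sym (f refl)
  ≡true-ext {false} {false} f g = refl
  ≡true-ext {false} {true}  f g = g refl

  ∧-true : ∀ {a b} → a ∧ b ≡ true → a ≡ true × b ≡ true
  ∧-true {true} {true} _ = refl , refl

  equivalent⇒degree≡ : ∀ {n} (R : Preorder n) {v x} → rel R v x ≡ true → rel R x v ≡ true → degree R x ≡ degree R v
  equivalent⇒degree≡ {n} R {v} {x} vx xv = cong₂ _+_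
    (sum-cong-≗ {n} λ y → cong ⟦_⟧ (≡true-ext {rel R x y} {rel R v y} (trans′ R vx) (trans′ R xv)))
    (sum-cong-≗ {n} λ y → cong ⟦_⟧ (≡true-ext {rel R y x} {rel R y v} (λ yx → trans′ R yx xv) (λ yv → trans′ R yv vx)))

  module _ {n} (R : Preorder (suc n)) {x} {v} (vx : rel R (punchIn x v) x ≡ true) (xv : rel R x (punchIn x v) ≡ true) where

    degree-delete : 2 + degree (delete R x) v ≡ degree R (punchIn x v)
    degree-delete = sym (trans (cong₂ _+_
        (trans (sum-remove {i = x} (λ y → ⟦ rel R (punchIn x v) y ⟧)) (cong (λ b → ⟦ b ⟧ + row) vx))
        (trans (sum-remove {i = x} (λ y → ⟦ rel R y (punchIn x v) ⟧)) (cong (λ b → ⟦ b ⟧ + col) xv)))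
      (cong suc (+-suc row col)))
      where
      row = sum λ y → ⟦ rel (delete R x) v y ⟧
      col = sum λ y → ⟦ rel (delete R x) y v ⟧

    classSize-delete : suc (classSize (delete R x) v) ≡ classSize R (punchIn x v)
    classSize-delete = sym (trans (sum-remove {i = x} (λ y → ⟦ rel R (punchIn x v) y ∧ rel R y (punchIn x v) ⟧))
      (cong₂ (λ a b → ⟦ a ∧ b ⟧ + classSize (delete R x) v) vx xv))

  -- The count includes `v`, so a size above 1 provides a second point `x`. Writing `v` as
  -- `punchIn x v′` names its copy after the deletion of `x`.
  twin : ∀ {n} (R : Preorder (suc n)) v → 1 < classSize R v →
    ∃₂ λ x v′ → punchIn x v′ ≡ v × rel R v x ≡ true × rel R x v ≡ true
  twin {n} R v lt = punchIn v i , punchOut x≢v , Fin.punchIn-punchOut x≢v , ∧-true (⟦⟧-pos (proj₂ other))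
    where
    both = λ x → ⟦ rel R v x ∧ rel R x v ⟧
    classSize≡ : classSize R v ≡ suc (sum (both ∘ punchIn v))
    classSize≡ = trans (sum-remove {i = v} both) (cong (λ b → ⟦ b ∧ b ⟧ + sum (both ∘ punchIn v)) (refl′ R v))
    other = sum>⇒∃> (both ∘ punchIn v) 0
      (subst (_< sum (both ∘ punchIn v)) (sym (*-zeroʳ n)) (s<s⁻¹ (subst (1 <_) classSize≡ lt)))
    i = proj₁ other
    x≢v = Fin.punchInᵢ≢i v i

  -- Deleting a twin costs the current degree d minus one and lowers the degree of the remaining
  -- class by two, so the losses d - 1, d - 3, ... add up to q d - q². The strict bound on `q` keeps
  -- a representative.
  shrinkClass : ∀ q {m} (R : Preorder (q + m)) v → q < classSize R v →
    ∃₂ λ (R′ : Preorder m) v′ → weight R′ + q * degree R v ≡ weight R + q * q × 2 * q + degree R′ v′ ≡ degree R v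
  shrinkClass zero    R v lt = R , v , refl , refl
  shrinkClass (suc q) R v lt
    with x , u , refl , vx , xv ← twin R v (≤-<-trans (s≤s z≤n) lt)
    with R′ , v′ , w≡ , d≡ ← shrinkClass q (delete R x) u
           (s<s⁻¹ (subst (suc q <_) (sym (classSize-delete R vx xv)) lt))
    = R′ , v′ , wt , dg
    where
    open ≡-Reasoning
    D = degree (delete R x) u
    wt : weight R′ + suc q * degree R (punchIn x u) ≡ weight R + suc q * suc q
    wt = begin
      weight R′ + (degree R v + q * degree R v)   ≡⟨ cong (λ d → weight R′ + (degree R v + q * d)) (degree-delete R vx xv) ⟨
      weight R′ + (degree R v + q * (2 + D))      ≡⟨ solve 4 (λ a b c d → a :+ (b :+ c :* (con 2 :+ d)) := a :+ c :* d :+ (con 2 :* c :+ b))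
                                                       refl (weight R′) (degree R v) q D ⟩
      weight R′ + q * D + (2 * q + degree R v)    ≡⟨ cong (_+ (2 * q + degree R v)) w≡ ⟩
      weight (delete R x) + q * q + (2 * q + degree R v)
        ≡⟨ solve 3 (λ a b c → a :+ b :* b :+ (con 2 :* b :+ c) := a :+ c :+ (con 2 :* b :+ b :* b)) refl (weight (delete R x)) q (degree R v) ⟩
      weight (delete R x) + degree R v + (2 * q + q * q)
        ≡⟨ cong (λ d → weight (delete R x) + d + (2 * q + q * q)) (equivalent⇒degree≡ R vx xv) ⟨
      weight (delete R x) + degree R x + (2 * q + q * q) ≡⟨ cong (_+ (2 * q + q * q)) (weight-delete R x) ⟩
      suc (weight R) + (2 * q + q * q)             ≡⟨ solve 2 (λ a b → con 1 :+ a :+ (con 2 :* b :+ b :* b) := a :+ (con 1 :+ b) :* (con 1 :+ b)) refl (weight R) q ⟩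
      weight R + suc q * suc q                     ∎
    dg : 2 * suc q + degree R′ v′ ≡ degree R (punchIn x u)
    dg = begin
      2 * suc q + degree R′ v′     ≡⟨ solve 2 (λ a b → con 2 :* (con 1 :+ a) :+ b := con 2 :+ (con 2 :* a :+ b)) refl q (degree R′ v′) ⟩
      2 + (2 * q + degree R′ v′)   ≡⟨ cong (2 +_) d≡ ⟩
      2 + D                        ≡⟨ degree-delete R vx xv ⟩
      degree R (punchIn x u)       ∎

  -- The last point deleted is the representative that `shrinkClass` kept, which admits `q` equal to
  -- the class size.
  removeFromClass : ∀ q {m n} (R : Preorder n) v → q + m ≡ n → q ≤ classSize R v →
    Σ (Preorder m) λ R′ → weight R′ + q * degree R v ≡ weight R + q * q
  removeFromClass zero    R v refl le = R , refl
  removeFromClass (suc q) {m} R v e le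
    with refl ← trans (sym e) (sym (+-suc q m))
    with R₁ , v₁ , w≡ , d≡ ← shrinkClass q R v le
    = delete R₁ v₁ , +-cancelʳ-≡ 1 _ _ (begin
        weight (delete R₁ v₁) + (d + q * d) + 1
          ≡⟨ cong (λ z → weight (delete R₁ v₁) + (z + q * d) + 1) d≡ ⟨
        weight (delete R₁ v₁) + (2 * q + degree R₁ v₁ + q * d) + 1
          ≡⟨ solve 4 (λ a b c e → a :+ (b :+ c :+ e) :+ con 1 := a :+ c :+ e :+ (b :+ con 1)) refl (weight (delete R₁ v₁)) (2 * q) (degree R₁ v₁) (q * d) ⟩
        weight (delete R₁ v₁) + degree R₁ v₁ + q * d + (2 * q + 1)
          ≡⟨ cong (λ z → z + q * d + (2 * q + 1)) (weight-delete R₁ v₁) ⟩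
        suc (weight R₁ + q * d) + (2 * q + 1)     ≡⟨ cong (λ z → suc z + (2 * q + 1)) w≡ ⟩
        suc (weight R + q * q) + (2 * q + 1)
          ≡⟨ solve 2 (λ a b → con 1 :+ (a :+ b :* b) :+ (con 2 :* b :+ con 1) := a :+ (con 1 :+ b) :* (con 1 :+ b) :+ con 1) refl (weight R) q ⟩
        weight R + suc q * suc q + 1              ∎)
    where
    open ≡-Reasoning
    d = degree R v

  -- Averaging over degrees, and weights that are avoided.

  ∃highDegree : ∀ {n} (R : Preorder n) b → n * b < weight R + weight R → ∃ λ v → b < degree R v
  ∃highDegree R b lt = sum>⇒∃> (degree R) b (subst (_ <_) (sym (sum-degree R)) lt)

  module _ {j p w : ℕ} (w<n : w < p + j) (j+1²<n+w : suc j * suc j < p + j + w) (3j≤n : 3 * j ≤ p + j) where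

    private
      n = p + j

    -- If the class of `v` has `p + i` points and `s` points are incomparable to `v`, then deleting
    -- `p` points of the class leaves weight w + p (s - i) on `j` points. For s > i this exceeds j²,
    -- for s < i it is below j, and s = i would put `w` into W(j).
    W-gap : 0 < w → ¬ InW j w → ¬ InW n (p * n + w)
    W-gap 0<w w∉ k∈ with W⇒weight k∈
    ... | R , wt with ∃highDegree R (2 * p) (subst (n * (2 * p) <_) (sym e) (m<m+n _ (≤-trans 0<w (m≤m+n w w))))
      where
      e : weight R + weight R ≡ n * (2 * p) + (w + w)
      e = trans (cong₂ _+_ wt wt) (solve 3 (λ a b c → (a :* b :+ c) :+ (a :* b :+ c) := b :* (con 2 :* a) :+ (c :+ c)) refl p n w)
    ... | v , 2p<d with p ≤? classSize R v
    ... | yes p≤c = large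
      where
      i s : ℕ
      i = proj₁ (m≤n⇒∃[o]m+o≡n p≤c)
      s = incomparable R v
      removed = removeFromClass p R v refl p≤c
      R′ = proj₁ removed
      balance : weight R′ + p * i ≡ w + p * s
      balance = +-cancelʳ-≡ (p * n + p * p) _ _ (begin
        weight R′ + p * i + (p * n + p * p)
          ≡⟨ solve 4 (λ a b c d → a :+ b :* c :+ (b :* d :+ b :* b) := a :+ b :* (d :+ (b :+ c))) refl (weight R′) p i n ⟩
        weight R′ + p * (n + (p + i))   ≡⟨ cong (λ c → weight R′ + p * (n + c)) (proj₂ (m≤n⇒∃[o]m+o≡n p≤c)) ⟩
        weight R′ + p * (n + classSize R v) ≡⟨ cong (λ c → weight R′ + p * c) (degree+incomparable R v) ⟨
        weight R′ + p * (degree R v + s)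
          ≡⟨ solve 4 (λ a b c d → a :+ b :* (c :+ d) := a :+ b :* c :+ b :* d) refl (weight R′) p (degree R v) s ⟩
        weight R′ + p * degree R v + p * s ≡⟨ cong (_+ p * s) (trans (proj₂ removed) (cong (_+ p * p) wt)) ⟩
        p * n + w + p * p + p * s
          ≡⟨ solve 4 (λ a b c d → a :* b :+ c :+ a :* a :+ a :* d := c :+ a :* d :+ (a :* b :+ a :* a)) refl p n w s ⟩
        w + p * s + (p * n + p * p)     ∎)
        where open ≡-Reasoning
      large : ⊥
      large with <-cmp i s
      ... | tri≈ _ i≡s _ = w∉ (subst (InW j) (+-cancelʳ-≡ _ _ _ (trans balance (cong (λ x → w + p * x) (sym i≡s)))) (weight∈W R′))
      ... | tri< i<s _ _ = <⇒≱ j+1²<n+w (begin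
            p + j + w             ≡⟨ solve 3 (λ a b c → a :+ b :+ c := c :+ a :+ b) refl p j w ⟩
            w + p + j             ≤⟨ +-monoˡ-≤ j (+-cancelʳ-≤ (p * i) _ _ (begin
              w + p + p * i         ≡⟨ solve 3 (λ a b c → a :+ b :+ b :* c := a :+ b :* (con 1 :+ c)) refl w p i ⟩
              w + p * suc i         ≤⟨ +-monoʳ-≤ w (*-monoʳ-≤ p i<s) ⟩
              w + p * s             ≡⟨ balance ⟨
              weight R′ + p * i     ≤⟨ +-monoˡ-≤ (p * i) (weight≤n² R′) ⟩
              j * j + p * i         ∎)) ⟩
            j * j + j             ≤⟨ m≤m+n _ (suc j) ⟩
            j * j + j + suc j     ≡⟨ solve 1 (λ a → a :* a :+ a :+ (con 1 :+ a) := (con 1 :+ a) :* (con 1 :+ a)) refl j ⟩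
            suc j * suc j         ∎)
        where open ≤-Reasoning
      ... | tri> _ _ s<i = <⇒≱ w<n (+-cancelʳ-≤ (p * s) _ _ (begin
            p + j + p * s         ≡⟨ solve 3 (λ a b c → a :+ b :+ a :* c := b :+ a :* (con 1 :+ c)) refl p j s ⟩
            j + p * suc s         ≤⟨ +-mono-≤ (n≤weight R′) (*-monoʳ-≤ p s<i) ⟩
            weight R′ + p * i     ≡⟨ balance ⟩
            w + p * s             ∎))
        where open ≤-Reasoning
    -- A class of c < p points is deleted entirely. With e = p - c, the other e + j points carry
    -- weight at least e n + w, and the degree of `v` forces e < j. This is too much for (e + j)²:
    -- at e = 1 by the hypothesis on `suc j * suc j`, and each further unit of e adds n to the
    -- weight but on average at most 3 j ≤ n to the square.
    ... | no p≰c = small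
      where
      c f e s m : ℕ
      c = classSize R v
      f = proj₁ (m≤n⇒∃[o]m+o≡n (≰⇒> p≰c))
      e = suc f
      s = incomparable R v
      m = e + j
      c+e≡p : c + e ≡ p
      c+e≡p = trans (+-suc c f) (proj₂ (m≤n⇒∃[o]m+o≡n (≰⇒> p≰c)))
      c+m≡n : c + m ≡ n
      c+m≡n = trans (sym (+-assoc c e j)) (cong (_+ j) c+e≡p)
      removed = removeFromClass c R v c+m≡n ≤-refl
      R′ = proj₁ removed
      balance : weight R′ ≡ e * n + w + c * s
      balance = +-cancelʳ-≡ (c * n + c * c) _ _ (begin
        weight R′ + (c * n + c * c)     ≡⟨ cong (weight R′ +_) (*-distribˡ-+ c n c) ⟨
        weight R′ + c * (n + c)         ≡⟨ cong (λ x → weight R′ + c * x) (degree+incomparable R v) ⟨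
        weight R′ + c * (degree R v + s) ≡⟨ solve 4 (λ a b c d → a :+ b :* (c :+ d) := a :+ b :* c :+ b :* d) refl (weight R′) c (degree R v) s ⟩
        weight R′ + c * degree R v + c * s ≡⟨ cong (_+ c * s) (trans (proj₂ removed) (cong (_+ c * c) (trans wt (cong (λ x → x * n + w) (sym c+e≡p))))) ⟩
        (c + e) * n + w + c * c + c * s
          ≡⟨ solve 5 (λ c e n w s → (c :+ e) :* n :+ w :+ c :* c :+ c :* s := e :* n :+ w :+ c :* s :+ (c :* n :+ c :* c)) refl c e n w s ⟩
        e * n + w + c * s + (c * n + c * c) ∎)
        where open ≡-Reasoning
      e<j : e < j
      e<j = +-cancelˡ-< (2 * c + e) _ _ (begin-strict
        2 * c + e + e           ≡⟨ solve 2 (λ a b → con 2 :* a :+ b :+ b := con 2 :* (a :+ b)) refl c e ⟩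
        2 * (c + e)             ≡⟨ cong (2 *_) c+e≡p ⟩
        2 * p                   <⟨ 2p<d ⟩
        degree R v              ≤⟨ m≤m+n _ s ⟩
        degree R v + s          ≡⟨ degree+incomparable R v ⟩
        n + c                   ≡⟨ cong (_+ c) c+m≡n ⟨
        c + (e + j) + c         ≡⟨ solve 3 (λ a b d → a :+ (b :+ d) :+ a := con 2 :* a :+ b :+ d) refl c e j ⟩
        2 * c + e + j           ∎)
        where open ≤-Reasoning
      e*n+w≤m² : e * n + w ≤ m * m
      e*n+w≤m² = ≤-trans (m≤m+n _ (c * s)) (subst (_≤ m * m) balance (weight≤n² R′))
      small : ⊥
      small = <⇒≱ j+1²<n+w (+-cancelʳ-≤ (f * n) _ _ (begin
        n + w + f * n           ≡⟨ solve 3 (λ a b c → a :+ b :+ c :* a := a :+ c :* a :+ b) refl n w f ⟩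
        e * n + w               ≤⟨ e*n+w≤m² ⟩
        (e + j) * (e + j)       ≡⟨ solve 2 (λ f j → (con 1 :+ f :+ j) :* (con 1 :+ f :+ j)
                                     := (con 1 :+ j) :* (con 1 :+ j) :+ f :* (con 2 :* j :+ (con 2 :+ f))) refl f j ⟩
        suc j * suc j + f * (2 * j + suc e) ≤⟨ +-monoʳ-≤ (suc j * suc j) (*-monoʳ-≤ f (+-monoʳ-≤ (2 * j) e<j)) ⟩
        suc j * suc j + f * (2 * j + j)     ≡⟨ cong (λ x → suc j * suc j + f * x) (solve 1 (λ j → con 2 :* j :+ j := con 3 :* j) refl j) ⟩
        suc j * suc j + f * (3 * j)         ≤⟨ +-monoʳ-≤ (suc j * suc j) (*-monoʳ-≤ f 3j≤n) ⟩
        suc j * suc j + f * n               ∎))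
        where open ≤-Reasoning

-- The greedy recursion common to both sequences.

module Sequences where

  open Preorders using (weight∈W; W⇒weight; weight≤n²; W-dominate; W-isolated; W-gap)
  open import Data.Nat
  open import Data.Nat.DivMod using (_/_)
  open import Data.Nat.Induction using (<-rec)
  open import Data.Nat.Properties
  open import Data.Nat.Solver using (module +-*-Solver)
  open import Data.Bool using (Bool; true; false; _∧_; _∨_; if_then_else_; T)
  open import Data.Bool.Properties using (T-∧)
  open import Data.Product
  open import Data.Sum using (inj₁; inj₂)
  open import Data.Unit using (tt)
  open import Function using (Equivalence)
  open import Relation.Binary.PropositionalEquality
  open import Relation.Nullary
  open +-*-Solver using (solve; _:=_; _:+_; _:*_; con)

  -- For n ≥ 3, value n = (n - j) n + value j, where j = index-at n is the largest index with value j + 2 κ < n + κ j.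
  module Greedy (κ : ℕ) (κ≤1 : κ ≤ 1) (v₀ v₁ v₂ : ℕ)
    (v₁<v₂ : 2 + v₁ ≤ v₂) (v₂≤ : v₂ ≤ 3 + v₁)
    (active₁ : v₁ + 2 * κ < 3 + κ * 1) (inactive₂ : 3 + κ * 2 ≤ v₂ + 2 * κ) where

    record State : Set where
      constructor _,_
      field
        table : ℕ → ℕ
        index : ℕ
    open State

    extend : (ℕ → ℕ) → ℕ → ℕ → ℕ → ℕ
    extend f n v x = if x ≤ᵇ n then f x else v

    seed : ℕ → ℕ
    seed 0 = v₀
    seed 1 = v₁
    seed 2 = v₂
    -- At 3 this is (3 - 1) · 3 + v₁, the recursion with index 1; above 3 it is a placeholder that
    -- `extend` replaces.
    seed _ = 6 + v₁

    -- Testing `suc j` alone finds the maximal index: from n to n + 1 the right side of the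
    -- condition at the next index rises by 1 + κ ≤ 2, while `value` rises by at least 2, so
    -- `suc (suc j)` remains inactive.
    next : ℕ → (ℕ → ℕ) → ℕ → ℕ
    next n f j = if f (suc j) + 2 * κ <ᵇ suc n + κ * suc j then suc j else j

    grow : ℕ → (ℕ → ℕ) → ℕ → State
    grow n f j = extend f n ((suc n ∸ j) * suc n + f j) , j

    state : ℕ → State
    state zero    = seed , 1
    state (suc k) = step (state k)
      where
      step : State → State
      step (f , j) = grow (3 + k) f (next (3 + k) f j)

    value index-at : ℕ → ℕ
    value n = table (state (n ∸ 3)) n
    index-at n = index (state (n ∸ 3))

    extend-old : ∀ f n v {x} → x ≤ n → extend f n v x ≡ f x
    extend-old f n v {x} x≤n with x ≤ᵇ n | ≤⇒≤ᵇ x≤n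
    ... | true | _ = refl

    extend-new : ∀ f n v → extend f n v (suc n) ≡ v
    extend-new f n v with suc n ≤ᵇ n in eq
    ... | false = refl
    ... | true  with () ← <-irrefl refl (≤ᵇ⇒≤ (suc n) n (subst T (sym eq) _))

    table-stable : ∀ k {x} → x ≤ 3 + k → table (state k) x ≡ value x
    table-stable zero    {0} _ = refl
    table-stable zero    {1} _ = refl
    table-stable zero    {2} _ = refl
    table-stable zero    {3} _ = refl
    table-stable zero    {suc (suc (suc (suc x)))} (s≤s (s≤s (s≤s ())))
    table-stable (suc k) {x} x≤ with m≤n⇒m<n∨m≡n x≤
    ... | inj₂ refl = refl
    ... | inj₁ x<   = trans (extend-old (table (state k)) (3 + k) _ (s≤s⁻¹ x<)) (table-stable k (s≤s⁻¹ x<))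

    record Block (n j : ℕ) : Set where
      constructor block
      field
        width     : ℕ
        width+j≡n : width + j ≡ n
        2≤width   : 2 ≤ width
        1≤j       : 1 ≤ j
        value≡    : value n ≡ width * n + value j
        active    : value j + 2 * κ < n + κ * j
        inactive  : n + κ * suc j ≤ value (suc j) + 2 * κ

    -- The lower bound keeps the index from jumping; the upper bound, the increment of m², limits
    -- how far `value j` can fall short of n.
    Grows : ℕ → Set
    Grows m = 2 + value m ≤ value (suc m) × value (suc m) ≤ value m + (2 * m + 1)

    Invariant : ℕ → Set
    Invariant n = Block n (index-at n) × (∀ m → 1 ≤ m → m < n → Grows m)

    invariant : ∀ k → Invariant (3 + k)
    invariant zero = block 2 refl ≤-refl ≤-refl refl active₁ inactive₂ , grows
      where
      grows : ∀ m → 1 ≤ m → m < 3 → Grows m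
      grows 1 _ _ = v₁<v₂ , subst (v₂ ≤_) (+-comm 3 v₁) v₂≤
      grows 2 _ _ = s≤s (s≤s (≤-trans v₂≤ (n≤1+n _))) , subst (6 + v₁ ≤_) (+-comm 5 v₂) (≤-trans (n≤1+n _) (+-monoʳ-≤ 5 v₁<v₂))
      grows (suc (suc (suc _))) _ (s≤s (s≤s (s≤s ())))
    invariant (suc k) with invariant k
    ... | block p p+j≡n 2≤p 1≤j v≡ act inact , grows = blk , grows′
      where
      n j : ℕ
      n = 3 + k
      j = index-at n
      f = table (state k)
      j+2≤n : 2 + j ≤ n
      j+2≤n = subst (2 + j ≤_) p+j≡n (+-monoˡ-≤ j 2≤p)
      test : Bool
      test = f (suc j) + 2 * κ <ᵇ suc n + κ * suc j
      value-suc : ∀ i → i ≤ n → next n f j ≡ i → value (suc n) ≡ (suc n ∸ i) * suc n + value i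
      value-suc i i≤n e = trans (extend-new f n ((suc n ∸ next n f j) * suc n + f (next n f j)))
        (trans (cong (λ x → (suc n ∸ x) * suc n + f x) e) (cong ((suc n ∸ i) * suc n +_) (table-stable k i≤n)))
      split : ∀ b → test ≡ b → Block (suc n) (index-at (suc n)) × Grows n
      split true eq = subst (Block (suc n)) (sym i′) (block p (trans (+-suc p j) (cong suc p+j≡n)) 2≤p (s≤s z≤n) v′
                      (subst (λ x → x + 2 * κ < suc n + κ * suc j) (table-stable k (≤-trans (n≤1+n _) j+2≤n))
                        (<ᵇ⇒< _ _ (subst T (sym eq) _)))
                      (begin
                        suc n + κ * suc (suc j)       ≡⟨ solve 3 (λ n κ j → con 1 :+ n :+ κ :* (con 2 :+ j) := n :+ κ :* (con 1 :+ j) :+ (con 1 :+ κ)) refl n κ j ⟩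
                        n + κ * suc j + (1 + κ)       ≤⟨ +-mono-≤ inact (s≤s κ≤1) ⟩
                        value (suc j) + 2 * κ + 2     ≡⟨ solve 2 (λ a b → a :+ b :+ con 2 := con 2 :+ a :+ b) refl (value (suc j)) (2 * κ) ⟩
                        2 + value (suc j) + 2 * κ     ≤⟨ +-monoˡ-≤ (2 * κ) (proj₁ (grows (suc j) (s≤s z≤n) j+2≤n)) ⟩
                        value (suc (suc j)) + 2 * κ   ∎))
                  , (begin
                        2 + value n                   ≡⟨ cong (2 +_) v≡ ⟩
                        2 + (p * n + value j)         ≡⟨ solve 2 (λ a b → con 2 :+ (a :+ b) := a :+ con 0 :+ (con 2 :+ b)) refl (p * n) (value j) ⟩
                        p * n + 0 + (2 + value j)     ≤⟨ +-mono-≤ (+-monoʳ-≤ (p * n) z≤n) (proj₁ g) ⟩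
                        p * n + p + value (suc j)     ≡⟨ solve 3 (λ p n v → p :* n :+ p :+ v := p :* (con 1 :+ n) :+ v) refl p n (value (suc j)) ⟩
                        p * suc n + value (suc j)     ≡⟨ v′ ⟨
                        value (suc n)                 ∎)
                  , (begin
                        value (suc n)                 ≡⟨ v′ ⟩
                        p * suc n + value (suc j)     ≤⟨ +-monoʳ-≤ (p * suc n) (proj₂ g) ⟩
                        p * suc n + (value j + (2 * j + 1))
                          ≡⟨ solve 4 (λ p n v j → p :* (con 1 :+ n) :+ (v :+ (con 2 :* j :+ con 1)) := p :* n :+ v :+ (p :+ j :+ j :+ con 1)) refl p n (value j) j ⟩
                        p * n + value j + (p + j + j + 1)
                          ≤⟨ +-monoʳ-≤ (p * n + value j) (+-monoˡ-≤ 1 (+-mono-≤ (≤-reflexive p+j≡n) (≤-trans (m≤n+m j 2) j+2≤n))) ⟩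
                        p * n + value j + (n + n + 1) ≡⟨ cong₂ _+_ (sym v≡) (cong (_+ 1) (solve 1 (λ n → n :+ n := con 2 :* n) refl n)) ⟩
                        value n + (2 * n + 1)         ∎)
        where
        open ≤-Reasoning
        i′ : next n f j ≡ suc j
        i′ = cong (λ b → if b then suc j else j) eq
        g = grows j 1≤j (≤-trans (n≤1+n _) j+2≤n)
        v′ : value (suc n) ≡ p * suc n + value (suc j)
        v′ = trans (value-suc (suc j) (≤-trans (n≤1+n _) j+2≤n) i′)
               (cong (λ x → x * suc n + value (suc j)) (trans (cong (_∸ j) (sym p+j≡n)) (m+n∸n≡m p j)))
      split false eq = subst (Block (suc n)) (sym i′) (block (suc p) (cong suc p+j≡n) (≤-trans 2≤p (n≤1+n p)) 1≤j v′ (m<n⇒m<1+n act)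
                      (subst (λ x → suc n + κ * suc j ≤ x + 2 * κ) (table-stable k (≤-trans (n≤1+n _) j+2≤n))
                        (≮⇒≥ λ lt → subst T eq (<⇒<ᵇ lt))))
                  , (begin
                        2 + value n                   ≡⟨ cong (2 +_) v≡ ⟩
                        2 + (p * n + value j)         ≡⟨ +-comm 2 _ ⟩
                        p * n + value j + 2           ≤⟨ +-monoʳ-≤ (p * n + value j) (≤-trans 2≤p (m≤m+n p (suc n))) ⟩
                        p * n + value j + (p + suc n) ≡⟨ e ⟨
                        value (suc n)                 ∎)
                  , (begin
                        value (suc n)                 ≡⟨ e ⟩
                        p * n + value j + (p + suc n) ≤⟨ +-monoʳ-≤ (p * n + value j) (+-monoˡ-≤ (suc n) (subst (p ≤_) p+j≡n (m≤m+n p j))) ⟩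
                        p * n + value j + (n + suc n) ≡⟨ cong₂ _+_ (sym v≡) (solve 1 (λ n → n :+ (con 1 :+ n) := con 2 :* n :+ con 1) refl n) ⟩
                        value n + (2 * n + 1)         ∎)
        where
        open ≤-Reasoning
        i′ : next n f j ≡ j
        i′ = cong (λ b → if b then suc j else j) eq
        v′ : value (suc n) ≡ suc p * suc n + value j
        v′ = trans (value-suc j (≤-trans (m≤n+m j 2) j+2≤n) i′)
               (cong (λ x → x * suc n + value j) (trans (cong (λ x → suc x ∸ j) (sym p+j≡n)) (m+n∸n≡m (suc p) j)))
        e : value (suc n) ≡ p * n + value j + (p + suc n)
        e = trans v′ (solve 3 (λ p n v → (con 1 :+ p) :* (con 1 :+ n) :+ v := p :* n :+ v :+ (p :+ (con 1 :+ n))) refl p n (value j))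
      blk = proj₁ (split test refl)
      grows′ : ∀ m → 1 ≤ m → m < suc n → Grows m
      grows′ m 1≤m m<1+n with m≤n⇒m<n∨m≡n (s≤s⁻¹ m<1+n)
      ... | inj₁ m<n  = grows m 1≤m m<n
      ... | inj₂ refl = proj₂ (split test refl)

    blocks : ∀ n → 3 ≤ n → Block n (index-at n)
    blocks (suc (suc (suc k))) _ = proj₁ (invariant k)
    blocks (suc zero) (s≤s ())
    blocks (suc (suc zero)) (s≤s (s≤s ()))

    value-grows : ∀ m → 1 ≤ m → Grows m
    value-grows m 1≤m = proj₂ (invariant m) m 1≤m (m≤n+m (suc m) 2)

  -- With κ = 0 the condition on the index is `value j < n`, as `W-gap` requires of w. The seeds n²
  -- + 1 are the least numbers above all weights on 0, 1 and 2 points.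
  module Upper = Greedy 0 z≤n 1 2 5 (m≤m+n 4 1) ≤-refl ≤-refl (m≤m+n 3 2)
  -- With κ = 1, inactivity of j + 1 reads n + j ≤ lower (j + 1) + 1: the block p n +
  -- [j + 1, lower (j + 1)] touches (p + 1) n + [j, lower j]. The seeds are n², as W(n) = [n, n²]
  -- for n ≤ 2.
  module Lower = Greedy 1 ≤-refl 0 1 4 (m≤m+n 3 1) ≤-refl ≤-refl (m≤m+n 5 1)

  upper lower : ℕ → ℕ
  upper = Upper.value
  lower = Lower.value

  -- Every weight from n to `lower n` occurs.

  0∈W : InW 0 0
  0∈W = weight∈W (record { rel = λ () ; refl′ = λ () ; trans′ = λ { {()} } })

  lower-lb : ∀ m → 2 * m + 1 ≤ lower (suc m)
  lower-lb zero    = ≤-refl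
  lower-lb (suc m) = subst (_≤ lower (2 + m)) (cong suc (trans (cong suc (+-assoc m (m + 0) 1)) (sym (trans (+-assoc m (suc (m + 0)) 1) (+-suc m (m + 0 + 1))))))
    (≤-trans (+-monoʳ-≤ 2 (lower-lb m)) (proj₁ (Lower.value-grows (suc m) (s≤s z≤n))))

  lower-spread : ∀ d j → lower (suc j) + (d + j) ≤ lower (suc (d + j)) + j
  lower-spread zero    j = ≤-refl
  lower-spread (suc d) j = ≤-trans (≤-reflexive (+-suc _ (d + j)))
    (≤-trans (s≤s (lower-spread d j)) (+-monoˡ-≤ j (≤-trans (n≤1+n _) (proj₁ (Lower.value-grows (suc (d + j)) (s≤s z≤n))))))

  -- A class of p + 1 points above a preorder on m points yields the block (p + 1) n + [m, lower m].
  -- Descending from the full width, m runs from j upwards and consecutive blocks touch; an isolated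
  -- point yields the weights below the last block.
  interval⊆W : ∀ n → 1 ≤ n → ∀ k → n ≤ k → k ≤ lower n → InW n k
  interval⊆W = <-rec (λ n → 1 ≤ n → ∀ k → n ≤ k → k ≤ lower n → InW n k) go
    where
    1∈W : InW 1 1
    1∈W = W-dominate 1 0∈W
    go : ∀ n → (∀ {m} → m < n → 1 ≤ m → ∀ k → m ≤ k → k ≤ lower m → InW m k) →
         1 ≤ n → ∀ k → n ≤ k → k ≤ lower n → InW n k
    go 1 rec 1≤n k n≤k k≤l with refl ← ≤-antisym n≤k k≤l = 1∈W
    go 2 rec 1≤n 2 n≤k k≤l = W-isolated 1∈W
    go 2 rec 1≤n 3 n≤k k≤l = W-dominate 1 1∈W
    go 2 rec 1≤n 4 n≤k k≤l = W-dominate 2 0∈W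
    go 2 rec 1≤n 1 (s≤s ()) k≤l
    go 2 rec 1≤n (suc (suc (suc (suc (suc k))))) n≤k (s≤s (s≤s (s≤s (s≤s ()))))
    go n@(suc (suc (suc n₀))) rec 1≤n k n≤k k≤l =
      cover (pred width) j (≤-reflexive suc-pred-width) (trans (cong (_+ j) suc-pred-width) width+j≡n) k n≤k
        (subst (k ≤_) (trans value≡ (cong (λ p → p * n + lower j) (sym suc-pred-width))) k≤l)
      where
      open Lower.Block (Lower.blocks n (s≤s (s≤s (s≤s z≤n))))
      j = Lower.index-at n
      suc-pred-width : suc (pred width) ≡ width
      suc-pred-width = suc-pred width {{>-nonZero (≤-trans (s≤s z≤n) 2≤width)}}
      1≤m : ∀ {p m} → suc p ≤ width → suc p + m ≡ n → 1 ≤ m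
      1≤m {p} {m} p<w e = ≤-trans 1≤j (+-cancelˡ-≤ width _ _ (≤-trans (≤-reflexive (trans width+j≡n (sym e))) (+-monoˡ-≤ m p<w)))
      stack : ∀ p m {k} → suc p ≤ width → suc p + m ≡ n → suc p * n + m ≤ k → k ≤ suc p * n + lower m → InW n k
      stack p m {k} p<w e lo hi with m≤n⇒∃[o]m+o≡n (≤-trans (m≤m+n (suc p * n) m) lo)
      ... | w , refl = subst (λ x → InW x (suc p * x + w)) e (W-dominate (suc p)
        (rec (subst (suc m ≤_) e (+-monoˡ-≤ m (s≤s (z≤n {p})))) (1≤m p<w e) w (+-cancelˡ-≤ (suc p * n) _ _ lo) (+-cancelˡ-≤ (suc p * n) _ _ hi)))
      cover : ∀ p m → suc p ≤ width → suc p + m ≡ n → ∀ k → n ≤ k → k ≤ suc p * n + lower m → InW n k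
      -- A dominating point gives weight at least n + (n - 1). An isolated point reaches lower (n -
      -- 1) + 1 ≥ 2 n - 2, so nothing is missed in between.
      cover zero (suc m) p<w refl (suc k) n≤k k≤ with k ≤? lower (suc m)
      ... | yes k≤l = W-isolated (rec ≤-refl (s≤s z≤n) k (s≤s⁻¹ n≤k) k≤l)
      ... | no  k≰l = stack 0 (suc m) p<w refl (begin
          1 * n + suc m        ≡⟨ solve 1 (λ m → con 1 :* (con 2 :+ m) :+ (con 1 :+ m) := con 2 :+ (con 2 :* m :+ con 1)) refl m ⟩
          2 + (2 * m + 1)      ≤⟨ +-monoʳ-≤ 2 (lower-lb m) ⟩
          2 + lower (suc m)    ≤⟨ s≤s (≰⇒> k≰l) ⟩
          suc k                ∎) k≤
        where open ≤-Reasoning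
      cover (suc p) m p<w e k n≤k k≤ with k ≤? suc p * n + lower (suc m)
      ... | yes k≤l = cover p (suc m) (≤-trans (n≤1+n _) p<w) (trans (cong suc (+-suc p m)) e) k n≤k k≤l
      ... | no  k≰l = stack (suc p) m p<w e (begin
          suc (suc p) * n + m             ≡⟨ solve 3 (λ p n m → (con 2 :+ p) :* n :+ m := (con 1 :+ p) :* n :+ (n :+ m)) refl p n m ⟩
          suc p * n + (n + m)             ≤⟨ +-monoʳ-≤ (suc p * n) gap ⟩
          suc p * n + suc (lower (suc m)) ≡⟨ +-suc (suc p * n) (lower (suc m)) ⟩
          suc (suc p * n + lower (suc m)) ≤⟨ ≰⇒> k≰l ⟩
          k                               ∎) k≤
        where
        open ≤-Reasoning
        j≤m : j ≤ m
        j≤m = +-cancelˡ-≤ width _ _ (≤-trans (≤-reflexive (trans width+j≡n (sym e))) (+-monoˡ-≤ m p<w))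
        d = m ∸ j
        -- At m = j this is the inactivity of `suc j`; it persists for larger m because `lower`
        -- rises by at least one per step.
        gap : n + m ≤ suc (lower (suc m))
        gap = +-cancelʳ-≤ (suc j) _ _ (begin
          n + m + suc j                  ≡⟨ solve 3 (λ n m j → n :+ m :+ (con 1 :+ j) := n :+ con 1 :* (con 1 :+ j) :+ m) refl n m j ⟩
          n + 1 * suc j + m              ≤⟨ +-monoˡ-≤ m inactive ⟩
          lower (suc j) + 2 * 1 + m      ≡⟨ solve 2 (λ l m → l :+ con 2 :* con 1 :+ m := con 2 :+ (l :+ m)) refl (lower (suc j)) m ⟩
          2 + (lower (suc j) + m)        ≤⟨ +-monoʳ-≤ 2 (subst (λ x → lower (suc j) + x ≤ lower (suc x) + j) (m∸n+n≡m j≤m) (lower-spread (m ∸ j) j)) ⟩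
          2 + (lower (suc m) + j)        ≡⟨ solve 2 (λ l j → con 2 :+ (l :+ j) := con 1 :+ l :+ (con 1 :+ j)) refl (lower (suc m)) j ⟩
          suc (lower (suc m)) + suc j    ∎)

  -- The weight `upper n` does not occur.

  record UpperBounds (n : ℕ) : Set where
    field
      square  : suc n * suc n ≤ 2 * upper n
      triple  : 3 * n ≤ suc (upper n)
      avoided : ¬ InW n (upper n)

  weight>n²∉W : ∀ {n k} → n * n < k → ¬ InW n k
  weight>n²∉W lt i with R , refl ← W⇒weight i = <⇒≱ lt (weight≤n² R)

  -- `square` and `triple` are carried along because, for w = upper j < n, they supply the
  -- hypotheses of `W-gap`: (j + 1)² ≤ 2 w < n + w and 3 j ≤ w + 1 ≤ n.
  upper-bounds : ∀ n → 1 ≤ n → UpperBounds n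
  upper-bounds = <-rec (λ n → 1 ≤ n → UpperBounds n) go
    where
    go : ∀ n → (∀ {m} → m < n → 1 ≤ m → UpperBounds m) → 1 ≤ n → UpperBounds n
    go 1 rec _ = record { square = ≤-refl ; triple = ≤-refl ; avoided = weight>n²∉W ≤-refl }
    go 2 rec _ = record { square = m≤m+n 9 1 ; triple = ≤-refl ; avoided = weight>n²∉W ≤-refl }
    go n@(suc (suc (suc m))) rec _ = record
      { square = subst (λ x → suc n * suc n ≤ 2 * x) (sym value≡) (*-cancelˡ-≤ 3 (begin
          3 * (suc n * suc n)                  ≤⟨ m≤m+n _ (m * m) ⟩
          3 * (suc n * suc n) + m * m          ≡⟨ solve 1 (λ m → con 3 :* ((con 4 :+ m) :* (con 4 :+ m)) :+ m :* m
                                                    := con 2 :* ((con 3 :+ m) :* (con 2 :* (con 3 :+ m))) :+ con 12) refl m ⟩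
          2 * (n * (2 * n)) + 12               ≤⟨ +-mono-≤ (*-monoʳ-≤ 2 (*-monoʳ-≤ n 2n≤3width)) (*-monoʳ-≤ 6 2≤w) ⟩
          2 * (n * (3 * width)) + 6 * w        ≡⟨ solve 3 (λ n p w → con 2 :* (n :* (con 3 :* p)) :+ con 6 :* w
                                                    := con 3 :* (con 2 :* (p :* n :+ w))) refl n width w ⟩
          3 * (2 * (width * n + w))            ∎))
      ; triple = subst (λ x → 3 * n ≤ suc x) (sym value≡) (*-cancelˡ-≤ 3 (begin
          3 * (3 * n)                          ≤⟨ m≤m+n _ (m * (2 * m + 3)) ⟩
          3 * (3 * n) + m * (2 * m + 3)        ≡⟨ solve 1 (λ m → con 3 :* (con 3 :* (con 3 :+ m)) :+ m :* (con 2 :* m :+ con 3)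
                                                    := (con 3 :+ m) :* (con 2 :* (con 3 :+ m)) :+ con 9) refl m ⟩
          n * (2 * n) + 9                      ≤⟨ +-mono-≤ (*-monoʳ-≤ n 2n≤3width) (*-monoʳ-≤ 3 (s≤s 2≤w)) ⟩
          n * (3 * width) + 3 * suc w          ≡⟨ solve 3 (λ n p w → n :* (con 3 :* p) :+ con 3 :* (con 1 :+ w)
                                                    := con 3 :* (con 1 :+ (p :* n :+ w))) refl n width w ⟩
          3 * suc (width * n + w)              ∎))
      ; avoided = subst₂ (λ x y → ¬ InW x y) width+j≡n (trans (cong (λ x → width * x + w) width+j≡n) (sym value≡))
          (W-gap (subst (w <_) (sym width+j≡n) w<n)
            (subst (λ x → suc j * suc j < x + w) (sym width+j≡n) (begin-strict
              suc j * suc j ≤⟨ U.square ⟩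
              w + (w + 0)   ≡⟨ cong (w +_) (+-identityʳ w) ⟩
              w + w         <⟨ +-monoˡ-< w w<n ⟩
              n + w ∎))
            (subst (3 * j ≤_) (sym width+j≡n) 3j≤n) 0<w U.avoided)
      }
      where
      open ≤-Reasoning
      open Upper.Block (Upper.blocks n (s≤s (s≤s (s≤s z≤n))))
      j w : ℕ
      j = Upper.index-at n
      w = upper j
      j<n : j < n
      j<n = subst (suc j ≤_) width+j≡n (+-monoˡ-≤ j (≤-trans (s≤s z≤n) 2≤width))
      module U = UpperBounds (rec j<n 1≤j)
      w<n : w < n
      w<n = subst₂ _<_ (+-identityʳ w) (+-identityʳ n) active
      3j≤n : 3 * j ≤ n
      3j≤n = ≤-trans U.triple w<n
      2≤w : 2 ≤ w
      2≤w = s≤s⁻¹ (≤-trans (*-monoʳ-≤ 3 1≤j) U.triple)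
      0<w : 0 < w
      0<w = ≤-trans (s≤s z≤n) 2≤w
      2n≤3width : 2 * n ≤ 3 * width
      2n≤3width = +-cancelʳ-≤ n _ _ (begin
        2 * n + n              ≡⟨ solve 1 (λ n → con 2 :* n :+ n := con 3 :* n) refl n ⟩
        3 * n                  ≡⟨ cong (3 *_) width+j≡n ⟨
        3 * (width + j)        ≡⟨ *-distribˡ-+ 3 width j ⟩
        3 * width + 3 * j      ≤⟨ +-monoʳ-≤ (3 * width) 3j≤n ⟩
        3 * width + n          ∎)

  -- Size of the index of `lower`.

  module _ {n : ℕ} (3≤n : 3 ≤ n) where

    open Lower.Block (Lower.blocks n 3≤n)

    private
      j = Lower.index-at n

    lower-active : lower j + 3 ≤ n + j
    lower-active = begin
      lower j + 3             ≡⟨ +-suc (lower j) 2 ⟩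
      suc (lower j + 2)       ≤⟨ active ⟩
      n + 1 * j               ≡⟨ cong (n +_) (*-identityˡ j) ⟩
      n + j                   ∎
      where open ≤-Reasoning

    lower-inactive : n ≤ lower j + j + 2
    lower-inactive = +-cancelʳ-≤ (suc j) _ _ (begin
      n + suc j                        ≡⟨ cong (n +_) (*-identityˡ (suc j)) ⟨
      n + 1 * suc j                    ≤⟨ inactive ⟩
      lower (suc j) + 2                ≤⟨ +-monoˡ-≤ 2 (proj₂ (Lower.value-grows j 1≤j)) ⟩
      lower j + (2 * j + 1) + 2        ≡⟨ solve 2 (λ l j → l :+ (con 2 :* j :+ con 1) :+ con 2 := l :+ j :+ con 2 :+ (con 1 :+ j)) refl (lower j) j ⟩
      lower j + j + 2 + suc j          ∎)
      where open ≤-Reasoning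

    lower-index<n : j < n
    lower-index<n = subst (suc j ≤_) width+j≡n (+-monoˡ-≤ j (≤-trans (s≤s z≤n) 2≤width))

  -- A crude bound that serves to limit the index: together with `lower-active` it gives j² ≤ 2 n.
  -- Half of n² is lax enough for the induction to close using only that the width is at least 2.
  lower-quadratic : ∀ n → 1 ≤ n → n * n + 2 * n ≤ 2 * lower n + 6
  lower-quadratic = <-rec (λ n → 1 ≤ n → n * n + 2 * n ≤ 2 * lower n + 6) go
    where
    step : ∀ n → (∀ {m} → m < n → 1 ≤ m → m * m + 2 * m ≤ 2 * lower m + 6) → 3 ≤ n → n * n + 2 * n ≤ 2 * lower n + 6
    step n rec 3≤n = begin
      n * n + 2 * n                              ≡⟨ cong (λ n → n * n + 2 * n) width+j≡n ⟨
      (p + j) * (p + j) + 2 * (p + j)            ≡⟨ solve 2 (λ p j → (p :+ j) :* (p :+ j) :+ con 2 :* (p :+ j)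
                                                      := p :* (p :+ con 2 :* j) :+ p :* con 2 :+ (j :* j :+ con 2 :* j)) refl p j ⟩
      p * (p + 2 * j) + p * 2 + (j * j + 2 * j)  ≤⟨ +-mono-≤ (+-monoʳ-≤ (p * (p + 2 * j)) (*-monoʳ-≤ p 2≤width)) (rec (lower-index<n 3≤n) 1≤j) ⟩
      p * (p + 2 * j) + p * p + (2 * lower j + 6) ≡⟨ solve 3 (λ p j l → p :* (p :+ con 2 :* j) :+ p :* p :+ (con 2 :* l :+ con 6)
                                                      := con 2 :* (p :* (p :+ j) :+ l) :+ con 6) refl p j (lower j) ⟩
      2 * (p * (p + j) + lower j) + 6            ≡⟨ cong (λ x → 2 * (p * x + lower j) + 6) width+j≡n ⟩
      2 * (p * n + lower j) + 6                  ≡⟨ cong (λ x → 2 * x + 6) value≡ ⟨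
      2 * lower n + 6                            ∎
      where
      open ≤-Reasoning
      open Lower.Block (Lower.blocks n 3≤n) renaming (width to p)
      j = Lower.index-at n
    go : ∀ n → (∀ {m} → m < n → 1 ≤ m → m * m + 2 * m ≤ 2 * lower m + 6) → 1 ≤ n → n * n + 2 * n ≤ 2 * lower n + 6
    go 1 rec _ = m≤m+n 3 5
    go 2 rec _ = m≤m+n 8 6
    go (suc (suc (suc m))) rec _ = step (3 + m) rec (s≤s (s≤s (s≤s z≤n)))

  lower-index² : ∀ {n} → 3 ≤ n → Lower.index-at n * Lower.index-at n ≤ 2 * n
  lower-index² {n} 3≤n = +-cancelʳ-≤ (2 * j) _ _ (begin
    j * j + 2 * j         ≤⟨ lower-quadratic j (Lower.Block.1≤j (Lower.blocks n 3≤n)) ⟩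
    2 * lower j + 6       ≡⟨ *-distribˡ-+ 2 (lower j) 3 ⟨
    2 * (lower j + 3)     ≤⟨ *-monoʳ-≤ 2 (lower-active 3≤n) ⟩
    2 * (n + j)           ≡⟨ *-distribˡ-+ 2 n j ⟩
    2 * n + 2 * j         ∎)
    where
    open ≤-Reasoning
    j = Lower.index-at n

  -- Numerical certificates for small indices.

  allBelow : ℕ → (ℕ → Bool) → Bool
  allBelow zero    p = true
  allBelow (suc n) p = p n ∧ allBelow n p

  allBelow-sound : ∀ n p → T (allBelow n p) → ∀ {i} → i < n → T (p i)
  allBelow-sound (suc n) p t {i} i<n with Equivalence.to (T-∧ {p n} {allBelow n p}) t | m≤n⇒m<n∨m≡n (s≤s⁻¹ i<n)
  ... | pn , rest | inj₁ i<n′ = allBelow-sound n p rest i<n′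
  ... | pn , rest | inj₂ refl = pn

  -- A / 16, B / 16 and C / 16 are lower bounds for the square, fourth and eighth root of t.
  record Certificate (t j : ℕ) : Set where
    field
      A B C  : ℕ
      A²≤    : A * A ≤ 256 * t
      B²≤    : B * B ≤ 16 * A
      C²≤    : C * C ≤ 16 * B
      16≤C   : 16 ≤ C
      C≡16   : t ≤ 1250 → C ≡ 16
      exceeds : 64 * (j * t + j + 2) < (4 * A + 2 * B + C + 80) * t

  -- √ stands for any function: each of its values is checked against the radicand before it is used.
  module Certification (√ : ℕ → ℕ) where

    module _ (t j : ℕ) where

      certify₃ : ℕ → ℕ → ℕ → Bool
      certify₃ A B C = (A * A ≤ᵇ 256 * t) ∧ ((B * B ≤ᵇ 16 * A) ∧ ((C * C ≤ᵇ 16 * B) ∧ ((16 ≤ᵇ C)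
        ∧ (64 * (j * t + j + 2) <ᵇ (4 * A + 2 * B + C + 80) * t))))

      -- Up to 1250 = 2 · 5 ^ 2 ^ 2 only two roots may enter the sum.
      third : ℕ → ℕ
      third B = if t ≤ᵇ 1250 then 16 else √ (16 * B)

      certify₂ : ℕ → ℕ → Bool
      certify₂ A B = certify₃ A B (third B)

      certify₁ : ℕ → Bool
      certify₁ A = certify₂ A (√ (16 * A))

      certify : Bool
      certify = certify₁ (√ (256 * t))

    certificate : ∀ t j → T (certify t j) → Certificate t j
    certificate t j ok = record
      { A = A ; B = B ; C = C
      ; A²≤ = ≤ᵇ⇒≤ _ _ (proj₁ s₁)
      ; B²≤ = ≤ᵇ⇒≤ _ _ (proj₁ s₂)
      ; C²≤ = ≤ᵇ⇒≤ _ _ (proj₁ s₃)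
      ; 16≤C = ≤ᵇ⇒≤ _ _ (proj₁ s₄)
      ; C≡16 = third≡16
      ; exceeds = <ᵇ⇒< _ _ (proj₂ s₄)
      }
      where
      A = √ (256 * t)
      B = √ (16 * A)
      C = third t j B
      s₁ = Equivalence.to (T-∧ {A * A ≤ᵇ 256 * t}) ok
      s₂ = Equivalence.to (T-∧ {B * B ≤ᵇ 16 * A}) (proj₂ s₁)
      s₃ = Equivalence.to (T-∧ {C * C ≤ᵇ 16 * B}) (proj₂ s₂)
      s₄ = Equivalence.to (T-∧ {16 ≤ᵇ C}) (proj₂ s₃)
      third≡16 : t ≤ 1250 → C ≡ 16
      third≡16 t≤ with t ≤ᵇ 1250 | ≤⇒≤ᵇ t≤
      ... | true | _ = refl

    certifyAll : ℕ → (ℕ → ℕ) → Bool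
    certifyAll m f = allBelow m (λ j → certify (f j + 3 ∸ j) j)

    certifyAll-sound : ∀ k m → m ≤ 3 + k → T (certifyAll m (Lower.State.table (Lower.state k))) →
      ∀ j → j < m → Certificate (lower j + 3 ∸ j) j
    certifyAll-sound k m m≤ ok j j<m = subst (λ v → Certificate (v + 3 ∸ j) j)
      (Lower.table-stable k (≤-trans (<⇒≤ j<m) m≤))
      (certificate (f j + 3 ∸ j) j (allBelow-sound m (λ j → certify (f j + 3 ∸ j) j) ok j<m))
      where f = Lower.State.table (Lower.state k)

    smallCertify : ℕ → Bool
    smallCertify n = (n <ᵇ 3) ∨ ((√ n * √ n ≤ᵇ n) ∧ (n * n <ᵇ lower n + n * (√ n + 1)))

    smallCertify-sound : T (allBelow 25 smallCertify) → ∀ n → 3 ≤ n → n < 25 → ∃ λ r → r * r ≤ n × n * n < lower n + n * (r + 1)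
    smallCertify-sound all n 3≤n n<25 with n <ᵇ 3 in eq | allBelow-sound 25 smallCertify all n<25
    ... | true  | _ with () ← <⇒≱ (<ᵇ⇒< n 3 (subst T (sym eq) tt)) 3≤n
    ... | false | ok = let a , b = Equivalence.to (T-∧ {√ n * √ n ≤ᵇ n}) ok in √ n , ≤ᵇ⇒≤ _ _ a , <ᵇ⇒< _ _ b

  newton : ℕ → ℕ → ℕ → ℕ
  newton zero    m x = if x * x ≤ᵇ m then x else pred x
  newton (suc k) m x = newton k m ((x + m / suc (pred x)) / 2)

  -- The start 8192 lies above every root taken, since the largest radicand is 256 t with t < 400².
  -- The iteration may stop one too high, which the last case of `newton` corrects.
  isqrt : ℕ → ℕ
  isqrt m = newton 20 m 8192

  -- `lower j + 3 ∸ j` bounds from below every n whose index is `j`, so one certificate serves all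
  -- of them. From j = 400 on `BelowStep` applies.
  lower-certificate : ∀ j → j < 400 → Certificate (lower j + 3 ∸ j) j
  lower-certificate = Certification.certifyAll-sound isqrt 397 400 ≤-refl tt

  small-certificate : ∀ n → 3 ≤ n → n < 25 → ∃ λ r → r * r ≤ n × n * n < lower n + n * (r + 1)
  small-certificate = Certification.smallCertify-sound isqrt tt

module Estimates where

  open Sequences
  open import Data.Nat as ℕ using (ℕ; zero; suc)
  open import Data.Nat.Induction using (<-rec)
  import Data.Nat.Properties as ℕ
  open import Data.Nat.Solver using (module +-*-Solver)
  open import Data.Integer as ℤ using (+_)
  import Data.Integer.Properties as ℤ
  open import Data.Rational
  open import Data.Rational.Properties
  import Data.Rational.Unnormalised as ℚᵘ
  import Data.Rational.Unnormalised.Properties as ℚᵘ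
  open import Data.Empty using (⊥-elim)
  open import Data.Maybe using (Maybe; just; nothing)
  open import Data.Product
  open import Data.Sum using (inj₁; inj₂)
  open import Relation.Binary.PropositionalEquality
  open import Relation.Nullary using (Dec; yes; no)
  open import Relation.Nullary.Decidable using (True; toWitness)
  open import Tactic.RingSolver using (solve-∀)
  open import Tactic.RingSolver.Core.AlmostCommutativeRing using (AlmostCommutativeRing; fromCommutativeRing)
  open +-*-Solver using (solve; _:=_; _:+_; _:*_; con)

  -- Rational inequalities by explicit nonnegative differences.

  ring : AlmostCommutativeRing _ _
  ring = fromCommutativeRing +-*-commutativeRing isZero
    where
    isZero : ∀ x → Maybe (0ℚ ≡ x)
    isZero x with x ≟ 0ℚ
    ... | yes x≡0 = just (sym x≡0)
    ... | no _    = nothing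

  toℚᵘ-fromℕ : ∀ k → toℚᵘ (fromℕ k) ℚᵘ.≃ ℚᵘ.mkℚᵘ (+ k) 0
  toℚᵘ-fromℕ k = toℚᵘ-fromℚᵘ (ℚᵘ.mkℚᵘ (+ k) 0)

  fromℕ-+ : ∀ a b → fromℕ (a ℕ.+ b) ≡ fromℕ a + fromℕ b
  fromℕ-+ a b = toℚᵘ-injective (begin
    toℚᵘ (fromℕ (a ℕ.+ b))                  ≈⟨ toℚᵘ-fromℕ (a ℕ.+ b) ⟩
    ℚᵘ.mkℚᵘ (+ (a ℕ.+ b)) 0                ≈⟨ ℚᵘ.*≡* (cong (ℤ._* + 1) (cong₂ ℤ._+_ (sym (ℤ.*-identityʳ (+ a))) (sym (ℤ.*-identityʳ (+ b))))) ⟩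
    ℚᵘ.mkℚᵘ (+ a) 0 ℚᵘ.+ ℚᵘ.mkℚᵘ (+ b) 0    ≈⟨ ℚᵘ.+-cong (toℚᵘ-fromℕ a) (toℚᵘ-fromℕ b) ⟨
    toℚᵘ (fromℕ a) ℚᵘ.+ toℚᵘ (fromℕ b)       ≈⟨ toℚᵘ-homo-+ (fromℕ a) (fromℕ b) ⟨
    toℚᵘ (fromℕ a + fromℕ b)                 ∎)
    where open ℚᵘ.≃-Reasoning

  fromℕ-* : ∀ a b → fromℕ (a ℕ.* b) ≡ fromℕ a * fromℕ b
  fromℕ-* a b = toℚᵘ-injective (begin
    toℚᵘ (fromℕ (a ℕ.* b))                  ≈⟨ toℚᵘ-fromℕ (a ℕ.* b) ⟩
    ℚᵘ.mkℚᵘ (+ (a ℕ.* b)) 0                ≈⟨ ℚᵘ.*≡* (cong (ℤ._* + 1) (ℤ.pos-* a b)) ⟩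
    ℚᵘ.mkℚᵘ (+ a) 0 ℚᵘ.* ℚᵘ.mkℚᵘ (+ b) 0    ≈⟨ ℚᵘ.*-cong (toℚᵘ-fromℕ a) (toℚᵘ-fromℕ b) ⟨
    toℚᵘ (fromℕ a) ℚᵘ.* toℚᵘ (fromℕ b)       ≈⟨ toℚᵘ-homo-* (fromℕ a) (fromℕ b) ⟨
    toℚᵘ (fromℕ a * fromℕ b)                 ∎)
    where open ℚᵘ.≃-Reasoning

  fromℕ-≤ : ∀ a b → a ℕ.≤ b → fromℕ a ≤ fromℕ b
  fromℕ-≤ a b a≤b = toℚᵘ-cancel-≤ (ℚᵘ.≤-respʳ-≃ (ℚᵘ.≃-sym (toℚᵘ-fromℕ b)) (ℚᵘ.≤-respˡ-≃ (ℚᵘ.≃-sym (toℚᵘ-fromℕ a))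
    (ℚᵘ.*≤* (ℤ.*-monoʳ-≤-nonNeg (+ 1) (ℤ.+≤+ a≤b)))))

  fromℕ-< : ∀ a b → a ℕ.< b → fromℕ a < fromℕ b
  fromℕ-< a b a<b = toℚᵘ-cancel-< (ℚᵘ.<-respʳ-≃ (ℚᵘ.≃-sym (toℚᵘ-fromℕ b)) (ℚᵘ.<-respˡ-≃ (ℚᵘ.≃-sym (toℚᵘ-fromℕ a))
    (ℚᵘ.*<* (ℤ.*-monoʳ-<-pos (+ 1) (ℤ.+<+ a<b)))))

  0≤fromℕ : ∀ k → 0ℚ ≤ fromℕ k
  0≤fromℕ k = fromℕ-≤ 0 k ℕ.z≤n

  0≤-* : ∀ {p q} → 0ℚ ≤ p → 0ℚ ≤ q → 0ℚ ≤ p * q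
  0≤-* {p} {q} 0≤p 0≤q = subst (_≤ p * q) (*-zeroʳ p) (*-monoˡ-≤-nonNeg p {{nonNegative 0≤p}} 0≤q)

  infixl 6 _⊕_
  infixr 7 _·_

  _⊕_ : ∀ {p q} → 0ℚ ≤ p → 0ℚ ≤ q → 0ℚ ≤ p + q
  _⊕_ = +-mono-≤

  0≤lit : ∀ p {_ : True (0ℚ ≤? p)} → 0ℚ ≤ p
  0≤lit p {0≤p} = toWitness 0≤p

  _·_ : ∀ p {_ : True (0ℚ ≤? p)} {q} → 0ℚ ≤ q → 0ℚ ≤ p * q
  _·_ p {0≤p} = 0≤-* (toWitness 0≤p)

  0≤-gap : ∀ {p q} → p ≤ q → 0ℚ ≤ q - p
  0≤-gap {p} {q} p≤q = subst (_≤ q - p) (+-inverseʳ p) (+-monoˡ-≤ (- p) p≤q)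

  0<-gap : ∀ {p q} → p < q → 0ℚ < q - p
  0<-gap {p} {q} p<q = subst (_< q - p) (+-inverseʳ p) (+-monoˡ-< (- p) p<q)

  0<-· : ∀ p {_ : True (0ℚ <? p)} {q} → 0ℚ < q → 0ℚ < p * q
  0<-· p {0<p} {q} 0<q = subst (_< p * q) (*-zeroʳ p) (*-monoʳ-<-pos p {{positive (toWitness 0<p)}} 0<q)

  -- The difference is written as a combination of nonnegative terms whose sign is assembled by
  -- `_⊕_` and `_·_`, and a ring identity confirms it. The term `d` is usually inferred from its
  -- sign proof.
  ≤-by : ∀ {p q} d → 0ℚ ≤ d → p + d ≡ q → p ≤ q
  ≤-by {p} d 0≤d e = subst₂ _≤_ (+-identityʳ p) e (+-monoʳ-≤ p 0≤d)

  <-by : ∀ {p q} d → 0ℚ < d → p + d ≡ q → p < q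
  <-by {p} d 0<d e = subst₂ _<_ (+-identityʳ p) e (+-monoʳ-< p 0<d)

  0≤-square : ∀ p → 0ℚ ≤ p * p
  0≤-square p with ≤-total 0ℚ p
  ... | inj₁ 0≤p = 0≤-* 0≤p 0≤p
  ... | inj₂ p≤0 = subst (0ℚ ≤_) (identity p) (0≤-* (0≤-gap p≤0) (0≤-gap p≤0))
    where
    identity : ∀ p → (0ℚ - p) * (0ℚ - p) ≡ p * p
    identity = solve-∀ ring

  -- Above N z Q and Below N z Q say that Q_N(z) ≤ Q and Q ≤ Q_N(z), where Q₀ = 2 and
  -- Q_{N+1}(z) = √z + Q_N(√z)/2, each square root being replaced by a rational bound r.
  Above : ℕ → ℚ → ℚ → Set
  Above zero    z Q = fromℕ 2 ≤ Q
  Above (suc N) z Q = ∃₂ λ r Q′ → 0ℚ ≤ r × z ≤ r * r × Above N r Q′ × r + ½ * Q′ ≤ Q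

  Below : ℕ → ℚ → ℚ → Set
  Below zero    z Q = Q ≤ fromℕ 2
  Below (suc N) z Q = ∃₂ λ r Q′ → 0ℚ ≤ r × r * r ≤ z × Below N r Q′ × Q ≤ r + ½ * Q′

  -- Monotonicity, scaling and growth of Q_N.

  Above-anti : ∀ N {z z′ Q} → z′ ≤ z → Above N z Q → Above N z′ Q
  Above-anti zero    z′≤z a = a
  Above-anti (suc N) z′≤z (r , Q′ , 0≤r , z≤r² , a , le) = r , Q′ , 0≤r , ≤-trans z′≤z z≤r² , a , le

  Below-mono : ∀ N {z z′ Q} → z ≤ z′ → Below N z Q → Below N z′ Q
  Below-mono zero    z≤z′ b = b
  Below-mono (suc N) z≤z′ (r , Q′ , 0≤r , r²≤z , b , le) = r , Q′ , 0≤r , ≤-trans r²≤z z≤z′ , b , le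

  -- The root is bounded by its tangent z/4 + 1 at z = 4, and (2/7, 16/7) is the fixed point of the
  -- resulting map on coefficients. The bound is for n = 3, 4, 5, close to the point of tangency.
  Above-linear : ∀ N {z} → 0ℚ ≤ z → Above N z (+ 2 / 7 * z + + 16 / 7)
  Above-linear zero {z} 0≤z = ≤-by _ ((+ 2 / 7) · 0≤z ⊕ 0≤lit (+ 2 / 7)) (identity z)
    where
    identity : ∀ z → + 2 / 1 + (+ 2 / 7 * z + + 2 / 7) ≡ + 2 / 7 * z + + 16 / 7
    identity = solve-∀ ring
  Above-linear (suc N) {z} 0≤z = r , _ , 0≤r , ≤-by _ (0≤-square (+ 1 / 4 * z - 1ℚ)) (square z) ,
    Above-linear N 0≤r , ≤-reflexive (linear z)
    where
    r = + 1 / 4 * z + 1ℚ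
    0≤r : 0ℚ ≤ r
    0≤r = (+ 1 / 4) · 0≤z ⊕ 0≤lit 1ℚ
    square : ∀ z → z + (+ 1 / 4 * z - 1ℚ) * (+ 1 / 4 * z - 1ℚ) ≡ (+ 1 / 4 * z + 1ℚ) * (+ 1 / 4 * z + 1ℚ)
    square = solve-∀ ring
    linear : ∀ z → + 1 / 4 * z + 1ℚ + ½ * (+ 2 / 7 * (+ 1 / 4 * z + 1ℚ) + + 16 / 7) ≡ + 2 / 7 * z + + 16 / 7
    linear = solve-∀ ring

  Below-2 : ∀ N {z} → 1ℚ ≤ z → Below N z (fromℕ 2)
  Below-2 zero    1≤z = ≤-refl
  Below-2 (suc N) 1≤z = 1ℚ , fromℕ 2 , 0≤lit 1ℚ , 1≤z , Below-2 N ≤-refl , ≤-refl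

  -- Scaling z by θ² scales its root by θ, and θ r ≥ θ² r for θ ≤ 1, so the induction applies at `r`
  -- with the same θ.
  Below-scale : ∀ N {z Q θ} → 0ℚ ≤ θ → θ ≤ 1ℚ → Below N z Q → Below N (θ * θ * z) (θ * Q)
  Below-scale zero {Q = Q} {θ} 0≤θ θ≤1 b =
    ≤-by _ (0≤-* 0≤θ (0≤-gap b) ⊕ (+ 2 / 1) · 0≤-gap θ≤1) (identity θ Q)
    where
    identity : ∀ θ Q → θ * Q + (θ * (+ 2 / 1 - Q) + + 2 / 1 * (1ℚ - θ)) ≡ + 2 / 1
    identity = solve-∀ ring
  Below-scale (suc N) {z} {Q} {θ} 0≤θ θ≤1 (r , Q′ , 0≤r , r²≤z , b , le) =
    θ * r , θ * Q′ , 0≤-* 0≤θ 0≤r ,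
    ≤-by _ (0≤-* (0≤-square θ) (0≤-gap r²≤z)) (square θ r z) ,
    Below-mono N (≤-by _ (0≤-* (0≤-* 0≤θ 0≤r) (0≤-gap θ≤1)) (shrink θ r)) (Below-scale N 0≤θ θ≤1 b) ,
    ≤-by _ (0≤-* 0≤θ (0≤-gap le)) (linear θ r Q Q′)
    where
    square : ∀ θ r z → θ * r * (θ * r) + θ * θ * (z - r * r) ≡ θ * θ * z
    square = solve-∀ ring
    shrink : ∀ θ r → θ * θ * r + θ * r * (1ℚ - θ) ≡ θ * r
    shrink = solve-∀ ring
    linear : ∀ θ r Q Q′ → θ * Q + θ * (r + ½ * Q′ - Q) ≡ θ * r + ½ * (θ * Q′)
    linear = solve-∀ ring

  -- The tangent at r = 11/4 to r² closes the induction.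
  Below⇒linear : ∀ N {z Q} → 0ℚ ≤ z → Below N z Q → Q ≤ + 1 / 5 * z + + 4 / 1
  Below⇒linear zero {z} {Q} 0≤z b = ≤-by _ (0≤-gap b ⊕ (+ 1 / 5) · 0≤z ⊕ 0≤lit (+ 2 / 1)) (identity z Q)
    where
    identity : ∀ z Q → Q + ((+ 2 / 1 - Q) + + 1 / 5 * z + + 2 / 1) ≡ + 1 / 5 * z + + 4 / 1
    identity = solve-∀ ring
  Below⇒linear (suc N) {z} {Q} 0≤z (r , Q′ , 0≤r , r²≤z , b , le) =
    ≤-by _ (0≤-gap le ⊕ ½ · 0≤-gap (Below⇒linear N 0≤r b) ⊕ (+ 1 / 5) · 0≤-gap r²≤z
        ⊕ (+ 1 / 5) · 0≤-square (r - + 11 / 4) ⊕ 0≤lit (+ 39 / 80))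
      (identity z Q r Q′)
    where
    identity : ∀ z Q r Q′ → Q + ((r + ½ * Q′ - Q) + ½ * (+ 1 / 5 * r + + 4 / 1 - Q′)
      + + 1 / 5 * (z - r * r) + + 1 / 5 * ((r - + 11 / 4) * (r - + 11 / 4)) + + 39 / 80) ≡ + 1 / 5 * z + + 4 / 1
    identity = solve-∀ ring

  -- Unfolding once and applying `Below⇒linear` gives Q ≤ 11/10 √z + 2. At z = 400 the square of
  -- this is 576, against 3/2 · 400 = 600, and the ratio improves as z grows.
  Below⇒square : ∀ N {z Q} → fromℕ 400 ≤ z → 0ℚ ≤ Q → Below N z Q → Q * Q ≤ + 3 / 2 * z
  Below⇒square N {z} {Q} 400≤z 0≤Q b with affine N b
    where
    affine : ∀ N → Below N z Q → ∃ λ r → 0ℚ ≤ r × r * r ≤ z × Q ≤ + 11 / 10 * r + + 2 / 1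
    affine zero    b = 0ℚ , ≤-refl , ≤-trans (0≤lit (fromℕ 400)) 400≤z , b
    affine (suc N) (r , Q′ , 0≤r , r²≤z , b , le) = r , 0≤r , r²≤z ,
      ≤-by _ (0≤-gap le ⊕ ½ · 0≤-gap (Below⇒linear N 0≤r b)) (identity r Q Q′)
      where
      identity : ∀ r Q Q′ → Q + ((r + ½ * Q′ - Q) + ½ * (+ 1 / 5 * r + + 4 / 1 - Q′)) ≡ + 11 / 10 * r + + 2 / 1
      identity = solve-∀ ring
  ... | r , 0≤r , r²≤z , le =
    ≤-by _ (0≤-* (0≤-gap le) ((+ 11 / 10) · 0≤r ⊕ 0≤lit (+ 2 / 1) ⊕ 0≤Q) ⊕ (+ 33 / 25) · 0≤-gap r²≤z
        ⊕ (+ 9 / 50) · 0≤-gap 400≤z ⊕ (+ 11 / 100) · 0≤-square (r - + 20 / 1) ⊕ 0≤lit (+ 24 / 1))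
      (identity z Q r)
    where
    identity : ∀ z Q r → Q * Q + ((+ 11 / 10 * r + + 2 / 1 - Q) * (+ 11 / 10 * r + + 2 / 1 + Q) + + 33 / 25 * (z - r * r)
      + + 9 / 50 * (z - + 400 / 1) + + 11 / 100 * ((r - + 20 / 1) * (r - + 20 / 1)) + + 24 / 1) ≡ + 3 / 2 * z
    identity = solve-∀ ring

  -- The witness J + 2 - Q/2 is the solution r of J² + 4J - JQ = r² - (Q/2 - 2)², so no root has to be extracted.
  Above-step : ∀ N {J n u Q} → 0ℚ < J → 0ℚ ≤ n → n ≤ u → u ≤ J * J → Above N J Q →
    u + J * Q ≤ J * J + fromℕ 4 * J → Above (suc N) n (J + fromℕ 2)
  Above-step N {J} {n} {u} {Q} 0<J 0≤n n≤u u≤J² a le with ≤-total Q (fromℕ 4)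
  -- Here J + 2 - Q/2 is at least J, where the bound `a` need not transfer. J itself serves as the
  -- root since n ≤ u ≤ J².
  ... | inj₁ Q≤4 = J , Q , <⇒≤ 0<J , ≤-trans n≤u u≤J² , a , ≤-by _ (½ · 0≤-gap Q≤4) (identity J Q)
    where
    identity : ∀ J Q → J + ½ * Q + ½ * (+ 4 / 1 - Q) ≡ J + + 2 / 1
    identity = solve-∀ ring
  ... | inj₂ 4≤Q = r , Q , 0≤r , n≤r² , Above-anti N r≤J a , ≤-reflexive (sum≡ J Q)
    where
    r = J + + 2 / 1 - ½ * Q
    Q≤J+4 : Q ≤ J + + 4 / 1
    Q≤J+4 = *-cancelˡ-≤-pos J {{positive 0<J}} (≤-by _ (0≤-gap le ⊕ ≤-trans 0≤n n≤u) (identity J Q u))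
      where
      identity : ∀ J Q u → J * Q + ((J * J + + 4 / 1 * J - (u + J * Q)) + u) ≡ J * (J + + 4 / 1)
      identity = solve-∀ ring
    0≤r : 0ℚ ≤ r
    0≤r = ≤-by _ (½ · 0≤-gap Q≤J+4 ⊕ ½ · <⇒≤ 0<J) (identity J Q)
      where
      identity : ∀ J Q → 0ℚ + (½ * (J + + 4 / 1 - Q) + ½ * J) ≡ J + + 2 / 1 - ½ * Q
      identity = solve-∀ ring
    n≤r² : n ≤ r * r
    n≤r² = ≤-by _ (0≤-gap n≤u ⊕ 0≤-gap le ⊕ 0≤-square (½ * Q - + 2 / 1)) (identity J Q u n)
      where
      identity : ∀ J Q u n → n + ((u - n) + (J * J + + 4 / 1 * J - (u + J * Q)) + (½ * Q - + 2 / 1) * (½ * Q - + 2 / 1))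
        ≡ (J + + 2 / 1 - ½ * Q) * (J + + 2 / 1 - ½ * Q)
      identity = solve-∀ ring
    r≤J : r ≤ J
    r≤J = ≤-by _ (½ · 0≤-gap 4≤Q) (identity J Q)
      where
      identity : ∀ J Q → J + + 2 / 1 - ½ * Q + ½ * (Q - + 4 / 1) ≡ J
      identity = solve-∀ ring
    sum≡ : ∀ J Q → J + + 2 / 1 - ½ * Q + ½ * Q ≡ J + + 2 / 1
    sum≡ = solve-∀ ring

  -- Used with x = j and l = lower j. The hypotheses give n ≥ x² - x Q - x + 3, whereas (x - h)² =
  -- x² - x Q - 3/2 x + h² and h² ≤ x/2, so ρ = x - h is at most √n. The 3/4 in `h` is 1/2 to match
  -- the term -x and 1/4 to pay for h².
  module BelowStep (N : ℕ) {x Q l n : ℚ} (400≤x : fromℕ 400 ≤ x) (0≤Q : 0ℚ ≤ Q) (b : Below N x Q)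
    (x²≤ : x * x ≤ l + x * Q) (l≤ : l + fromℕ 3 ≤ n + x) where

    private
      0<x : 0ℚ < x
      0<x = <-≤-trans (toWitness {a? = 0ℚ <? fromℕ 400} _) 400≤x

      instance
        x-positive : Positive x
        x-positive = positive 0<x
        x-nonZero : NonZero x
        x-nonZero = pos⇒nonZero x

      h η θ ρ : ℚ
      h = ½ * Q + + 3 / 4
      η = h * 1/ x
      -- Slope 9/16 instead of 1/2 puts this line below √(1 - η) for 0 ≤ η ≤ 1/4, so θ² x ≤ x - h =
      -- ρ.
      θ = 1ℚ - + 9 / 16 * η
      ρ = x - h

      xη≡h : x * η ≡ h
      xη≡h = trans (cong (x *_) (*-comm h (1/ x))) (trans (sym (*-assoc x (1/ x) h))
        (trans (cong (_* h) (*-inverseʳ x)) (*-identityˡ h)))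

      Q²≤ : Q * Q ≤ + 3 / 2 * x
      Q²≤ = Below⇒square N 400≤x 0≤Q b

      Q≤ : Q ≤ + 1 / 32 * x + + 12 / 1
      Q≤ = ≤-by _ ((+ 1 / 48) · 0≤-gap Q²≤ ⊕ (+ 1 / 48) · 0≤-square (Q - + 24 / 1)) (identity x Q)
        where
        identity : ∀ x Q → Q + (+ 1 / 48 * (+ 3 / 2 * x - Q * Q) + + 1 / 48 * ((Q - + 24 / 1) * (Q - + 24 / 1)))
          ≡ + 1 / 32 * x + + 12 / 1
        identity = solve-∀ ring

      h≤x/4 : h ≤ x * (+ 1 / 4)
      h≤x/4 = ≤-by _ (½ · 0≤-gap Q≤ ⊕ (+ 15 / 64) · 0≤-gap 400≤x ⊕ 0≤lit (+ 87 / 1)) (identity x Q)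
        where
        identity : ∀ x Q → ½ * Q + + 3 / 4 + (½ * (+ 1 / 32 * x + + 12 / 1 - Q) + + 15 / 64 * (x - + 400 / 1) + + 87 / 1)
          ≡ x * (+ 1 / 4)
        identity = solve-∀ ring

      η≤1/4 : η ≤ + 1 / 4
      η≤1/4 = *-cancelˡ-≤-pos x (subst (_≤ x * (+ 1 / 4)) (sym xη≡h) h≤x/4)

      0≤η : 0ℚ ≤ η
      0≤η = 0≤-* (½ · 0≤Q ⊕ 0≤lit (+ 3 / 4)) (<⇒≤ (positive⁻¹ (1/ x) {{1/pos⇒pos x}}))

      ηQ≤4/5 : η * Q ≤ + 4 / 5
      ηQ≤4/5 = *-cancelˡ-≤-pos x (subst (_≤ x * (+ 4 / 5)) (trans (cong (_* Q) (sym xη≡h)) (*-assoc x η Q)) hQ≤)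
        where
        hQ≤ : h * Q ≤ x * (+ 4 / 5)
        hQ≤ = ≤-by _ (½ · 0≤-gap Q²≤ ⊕ (+ 3 / 4) · 0≤-gap Q≤ ⊕ (+ 17 / 640) · 0≤-gap 400≤x ⊕ 0≤lit (+ 13 / 8)) (identity x Q)
          where
          identity : ∀ x Q → (½ * Q + + 3 / 4) * Q + (½ * (+ 3 / 2 * x - Q * Q) + + 3 / 4 * (+ 1 / 32 * x + + 12 / 1 - Q)
            + + 17 / 640 * (x - + 400 / 1) + + 13 / 8) ≡ x * (+ 4 / 5)
          identity = solve-∀ ring

      0≤θ : 0ℚ ≤ θ
      0≤θ = ≤-by _ ((+ 9 / 16) · 0≤-gap η≤1/4 ⊕ 0≤lit (+ 55 / 64)) (identity η)
        where
        identity : ∀ η → 0ℚ + (+ 9 / 16 * (+ 1 / 4 - η) + + 55 / 64) ≡ 1ℚ - + 9 / 16 * η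
        identity = solve-∀ ring

      θ≤1 : θ ≤ 1ℚ
      θ≤1 = ≤-by _ ((+ 9 / 16) · 0≤η) (identity η)
        where
        identity : ∀ η → 1ℚ - + 9 / 16 * η + + 9 / 16 * η ≡ 1ℚ
        identity = solve-∀ ring

      θ²x≤ρ : θ * θ * x ≤ ρ
      θ²x≤ρ = ≤-by _ (0≤-* (0≤-* (<⇒≤ 0<x) 0≤η) ((+ 81 / 256) · 0≤-gap η≤1/4 ⊕ 0≤lit (+ 47 / 1024)))
        (trans (identity x η) (cong (λ y → x - y) xη≡h))
        where
        identity : ∀ x η → (1ℚ - + 9 / 16 * η) * (1ℚ - + 9 / 16 * η) * x
          + x * η * (+ 81 / 256 * (+ 1 / 4 - η) + + 47 / 1024) ≡ x - x * η
        identity = solve-∀ ring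

      0≤ρ : 0ℚ ≤ ρ
      0≤ρ = ≤-by _ (0≤-gap h≤x/4 ⊕ (+ 3 / 4) · <⇒≤ 0<x) (identity x h)
        where
        identity : ∀ x h → 0ℚ + (x * (+ 1 / 4) - h + + 3 / 4 * x) ≡ x - h
        identity = solve-∀ ring

      ρ²≤n : ρ * ρ ≤ n
      ρ²≤n = ≤-by _ (0≤-gap l≤ ⊕ 0≤-gap x²≤ ⊕ (+ 1 / 4) · 0≤-gap Q²≤ ⊕ (+ 3 / 4) · 0≤-gap Q≤
          ⊕ (+ 13 / 128) · 0≤-gap 400≤x ⊕ 0≤lit (+ 545 / 16)) (identity x Q l n)
        where
        identity : ∀ x Q l n → (x - (½ * Q + + 3 / 4)) * (x - (½ * Q + + 3 / 4))
          + (n + x - (l + + 3 / 1) + (l + x * Q - x * x) + + 1 / 4 * (+ 3 / 2 * x - Q * Q)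
            + + 3 / 4 * (+ 1 / 32 * x + + 12 / 1 - Q) + + 13 / 128 * (x - + 400 / 1) + + 545 / 16) ≡ n
        identity = solve-∀ ring

    Qₙ : ℚ
    Qₙ = ρ + ½ * (θ * Q)

    Below-Qₙ : Below (suc N) n Qₙ
    Below-Qₙ = ρ , θ * Q , 0≤ρ , ρ²≤n , Below-mono N θ²x≤ρ (Below-scale N 0≤θ θ≤1 b) , ≤-refl

    0≤Qₙ : 0ℚ ≤ Qₙ
    0≤Qₙ = 0≤ρ ⊕ ½ · 0≤-* 0≤θ 0≤Q

    -- The halves of Q cancel and leave 3/4 + 9/32 η Q, where η Q ≤ 4/5; the total 39/40 has to stay
    -- below 1.
    x≤Qₙ : x ≤ Qₙ + + 39 / 40
    x≤Qₙ = ≤-by _ ((+ 9 / 32) · 0≤-gap ηQ≤4/5) (identity x Q η)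
      where
      identity : ∀ x Q η → x + + 9 / 32 * (+ 4 / 5 - η * Q)
        ≡ x - (½ * Q + + 3 / 4) + ½ * ((1ℚ - + 9 / 16 * η) * Q) + + 39 / 40
      identity = solve-∀ ring

  -- The bound upper n ≤ g(n) + 2 n.

  upper≤n² : ∀ n → 3 ℕ.≤ n → upper n ℕ.≤ n ℕ.* n
  upper≤n² n 3≤n = begin
    upper n                          ≡⟨ value≡ ⟩
    -- The remainder satisfies upper j < n ≤ j n, although the seeds themselves are n² + 1.
    width ℕ.* n ℕ.+ upper j          ≤⟨ ℕ.+-monoʳ-≤ (width ℕ.* n) (ℕ.≤-trans (ℕ.<⇒≤ w<n) (subst (ℕ._≤ j ℕ.* n) (ℕ.*-identityˡ n) (ℕ.*-monoˡ-≤ n 1≤j))) ⟩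
    width ℕ.* n ℕ.+ j ℕ.* n          ≡⟨ ℕ.*-distribʳ-+ n width j ⟨
    (width ℕ.+ j) ℕ.* n              ≡⟨ cong (ℕ._* n) width+j≡n ⟩
    n ℕ.* n                          ∎
    where
    open ℕ.≤-Reasoning
    open Upper.Block (Upper.blocks n 3≤n)
    j = Upper.index-at n
    w<n : upper j ℕ.< n
    w<n = subst₂ ℕ._<_ (ℕ.+-identityʳ _) (ℕ.+-identityʳ n) active

  -- Because `upper 2` is 5. This is why the induction step starts at n = 6: the smaller argument J
  -- must again be at least 3.
  6≤upper⇒3≤ : ∀ m → 2 ℕ.≤ m → 6 ℕ.≤ upper m → 3 ℕ.≤ m
  6≤upper⇒3≤ m 2≤m 6≤u with ℕ.m≤n⇒m<n∨m≡n 2≤m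
  ... | inj₁ 2<m  = 2<m
  ... | inj₂ refl with () ← ℕ.≤⇒≤ᵇ 6≤u

  -- This is upper n ≤ g(n) + 2 n with `Q` for Q_N(n). All N are treated at once, as the case N + 1
  -- at n uses the case N at a smaller argument.
  UpperWitness : ℕ → Set
  UpperWitness n = ∀ N → ∃ λ Q → Above N (fromℕ n) Q ×
    fromℕ (upper n) + fromℕ n * Q ≤ fromℕ n * fromℕ n + fromℕ 4 * fromℕ n

  upper-witness : ∀ n → 3 ℕ.≤ n → UpperWitness n
  upper-witness = <-rec (λ n → 3 ℕ.≤ n → UpperWitness n) go
    where
    small : ∀ n → fromℕ (upper n) + fromℕ n * (+ 2 / 7 * fromℕ n + + 16 / 7) ≤ fromℕ n * fromℕ n + fromℕ 4 * fromℕ n →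
      UpperWitness n
    small n le N = + 2 / 7 * fromℕ n + + 16 / 7 , Above-linear N (0≤fromℕ n) , le
    base : ∀ n → 3 ℕ.≤ n → n ℕ.< 6 → UpperWitness n
    base 1 (ℕ.s≤s ()) _
    base 2 (ℕ.s≤s (ℕ.s≤s ())) _
    base 3 _ _ = small 3 (≤ᵇ⇒≤ _)
    base 4 _ _ = small 4 (≤ᵇ⇒≤ _)
    base 5 _ _ = small 5 (≤ᵇ⇒≤ _)
    base (suc (suc (suc (suc (suc (suc _)))))) _ (ℕ.s≤s (ℕ.s≤s (ℕ.s≤s (ℕ.s≤s (ℕ.s≤s (ℕ.s≤s ()))))))
    step : ∀ n → (∀ {m} → m ℕ.< n → 3 ℕ.≤ m → UpperWitness m) → 3 ℕ.≤ n → 6 ℕ.≤ n → UpperWitness n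
    -- For J = j + 1 one has upper j < n ≤ upper J. The value J + 2 is the largest Q with width · n
    -- + n + n Q ≤ n² + 4 n.
    step n rec 3≤n 6≤n N = fromℕ (suc j) + fromℕ 2 , above N , bound
      where
      open Upper.Block (Upper.blocks n 3≤n)
      j = Upper.index-at n
      n≤uJ : n ℕ.≤ upper (suc j)
      n≤uJ = subst₂ ℕ._≤_ (ℕ.+-identityʳ n) (ℕ.+-identityʳ _) inactive
      3≤J : 3 ℕ.≤ suc j
      3≤J = 6≤upper⇒3≤ (suc j) (ℕ.s≤s 1≤j) (ℕ.≤-trans 6≤n n≤uJ)
      J<n : suc j ℕ.< n
      J<n = subst (2 ℕ.+ j ℕ.≤_) width+j≡n (ℕ.+-monoˡ-≤ j 2≤width)
      above : ∀ N → Above N (fromℕ n) (fromℕ (suc j) + fromℕ 2)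
      above zero    = ≤-by _ (0≤fromℕ (suc j)) (+-comm (fromℕ 2) (fromℕ (suc j)))
      above (suc N) =
        let Q , a , le = rec J<n 3≤J N in
        Above-step N (fromℕ-< 0 (suc j) (ℕ.s≤s ℕ.z≤n)) (0≤fromℕ n) (fromℕ-≤ n (upper (suc j)) n≤uJ)
          (subst (fromℕ (upper (suc j)) ≤_) (fromℕ-* (suc j) (suc j))
            (fromℕ-≤ (upper (suc j)) (suc j ℕ.* suc j) (upper≤n² (suc j) 3≤J)))
          a le
      boundℕ : upper n ℕ.+ n ℕ.* (suc j ℕ.+ 2) ℕ.≤ n ℕ.* n ℕ.+ 4 ℕ.* n
      boundℕ = begin
        upper n ℕ.+ n ℕ.* (suc j ℕ.+ 2)                      ≡⟨ cong (ℕ._+ n ℕ.* (suc j ℕ.+ 2)) value≡ ⟩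
        width ℕ.* n ℕ.+ upper j ℕ.+ n ℕ.* (suc j ℕ.+ 2)
          ≤⟨ ℕ.+-monoˡ-≤ (n ℕ.* (suc j ℕ.+ 2)) (ℕ.+-monoʳ-≤ (width ℕ.* n) (ℕ.<⇒≤ (subst₂ ℕ._<_ (ℕ.+-identityʳ _) (ℕ.+-identityʳ n) active))) ⟩
        width ℕ.* n ℕ.+ n ℕ.+ n ℕ.* (suc j ℕ.+ 2)
          ≡⟨ solve 3 (λ p n j → p :* n :+ n :+ n :* (con 1 :+ j :+ con 2) := (p :+ j) :* n :+ con 4 :* n) refl width n j ⟩
        (width ℕ.+ j) ℕ.* n ℕ.+ 4 ℕ.* n                       ≡⟨ cong (λ x → x ℕ.* n ℕ.+ 4 ℕ.* n) width+j≡n ⟩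
        n ℕ.* n ℕ.+ 4 ℕ.* n                                   ∎
        where open ℕ.≤-Reasoning
      bound : fromℕ (upper n) + fromℕ n * (fromℕ (suc j) + fromℕ 2) ≤ fromℕ n * fromℕ n + fromℕ 4 * fromℕ n
      bound = subst₂ _≤_
        (trans (fromℕ-+ (upper n) (n ℕ.* (suc j ℕ.+ 2))) (cong (λ y → fromℕ (upper n) + y) (trans (fromℕ-* n (suc j ℕ.+ 2)) (cong (fromℕ n *_) (fromℕ-+ (suc j) 2)))))
        (trans (fromℕ-+ (n ℕ.* n) (4 ℕ.* n)) (cong₂ _+_ (fromℕ-* n n) (fromℕ-* 4 n)))
        (fromℕ-≤ (upper n ℕ.+ n ℕ.* (suc j ℕ.+ 2)) (n ℕ.* n ℕ.+ 4 ℕ.* n) boundℕ)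
    go : ∀ n → (∀ {m} → m ℕ.< n → 3 ℕ.≤ m → UpperWitness m) → 3 ℕ.≤ n → UpperWitness n
    go n rec 3≤n with n ℕ.<? 6
    ... | yes n<6 = base n 3≤n n<6
    ... | no  n≮6 = step n rec 3≤n (ℕ.≮⇒≥ n≮6)

  -- The bound g(n) - 2 n < lower n.

  module _ {t j : ℕ} (cert : Certificate t j) where

    open Certificate cert

    certifiedQ : ℚ
    certifiedQ = + 1 / 64 * fromℕ (4 ℕ.* A ℕ.+ 2 ℕ.* B ℕ.+ C ℕ.+ 16)

    private
      a b c : ℚ
      a = fromℕ A
      b = fromℕ B
      c = fromℕ C

      Q≡ : certifiedQ ≡ + 1 / 64 * (fromℕ 4 * a + fromℕ 2 * b + c + fromℕ 16)
      Q≡ = cong (+ 1 / 64 *_) (trans (fromℕ-+ (4 ℕ.* A ℕ.+ 2 ℕ.* B ℕ.+ C) 16) (cong (λ x → x + fromℕ 16)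
        (trans (fromℕ-+ (4 ℕ.* A ℕ.+ 2 ℕ.* B) C) (cong (λ x → x + c)
          (trans (fromℕ-+ (4 ℕ.* A) (2 ℕ.* B)) (cong₂ _+_ (fromℕ-* 4 A) (fromℕ-* 2 B)))))))

      scale : ∀ x y → x ℕ.* x ℕ.≤ 16 ℕ.* y → + 1 / 16 * fromℕ x * (+ 1 / 16 * fromℕ x) ≤ + 1 / 16 * fromℕ y
      scale x y le = ≤-by _ ((+ 1 / 256) · 0≤-gap (subst₂ _≤_ (fromℕ-* x x) (fromℕ-* 16 y) (fromℕ-≤ (x ℕ.* x) (16 ℕ.* y) le)))
        (identity (fromℕ x) (fromℕ y))
        where
        identity : ∀ x y → + 1 / 16 * x * (+ 1 / 16 * x) + + 1 / 256 * (+ 16 / 1 * y - x * x) ≡ + 1 / 16 * y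
        identity = solve-∀ ring

      0≤/16 : ∀ x → 0ℚ ≤ + 1 / 16 * fromℕ x
      0≤/16 x = (+ 1 / 16) · 0≤fromℕ x

    0≤certifiedQ : 0ℚ ≤ certifiedQ
    0≤certifiedQ = (+ 1 / 64) · 0≤fromℕ (4 ℕ.* A ℕ.+ 2 ℕ.* B ℕ.+ C ℕ.+ 16)

    Below-certifiedQ : ∀ M n → t ℕ.≤ n → (M ≡ 0 → t ℕ.≤ 1250) → Below (2 ℕ.+ M) (fromℕ n) certifiedQ
    Below-certifiedQ M n t≤n small =
      + 1 / 16 * a , + 1 / 16 * b + ½ * Q₃ M , 0≤/16 A , a²≤n ,
      (+ 1 / 16 * b , Q₃ M , 0≤/16 B , scale B A B²≤ , below₃ M , ≤-refl) , ≤-reflexive (trans Q≡ (total M small))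
      where
      -- For M = 0 the value Q₀ = 2 stands in place of a third root, and it agrees with C/16 + 1 for
      -- C = 16.
      Q₃ : ℕ → ℚ
      Q₃ zero    = fromℕ 2
      Q₃ (suc M) = + 1 / 16 * c + ½ * fromℕ 2
      a²≤n : + 1 / 16 * a * (+ 1 / 16 * a) ≤ fromℕ n
      a²≤n = ≤-by _ ((+ 1 / 256) · 0≤-gap (subst₂ _≤_ (fromℕ-* A A) (fromℕ-* 256 n)
          (fromℕ-≤ (A ℕ.* A) (256 ℕ.* n) (ℕ.≤-trans A²≤ (ℕ.*-monoʳ-≤ 256 t≤n))))) (identity a (fromℕ n))
        where
        identity : ∀ x y → + 1 / 16 * x * (+ 1 / 16 * x) + + 1 / 256 * (+ 256 / 1 * y - x * x) ≡ y
        identity = solve-∀ ring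
      1≤c/16 : 1ℚ ≤ + 1 / 16 * c
      1≤c/16 = ≤-by _ ((+ 1 / 16) · 0≤-gap (fromℕ-≤ 16 C 16≤C)) (identity c)
        where
        identity : ∀ x → 1ℚ + + 1 / 16 * (x - + 16 / 1) ≡ + 1 / 16 * x
        identity = solve-∀ ring
      below₃ : ∀ M → Below M (+ 1 / 16 * b) (Q₃ M)
      below₃ zero    = ≤-refl
      below₃ (suc M) = + 1 / 16 * c , fromℕ 2 , 0≤/16 C , scale C B C²≤ , Below-2 M 1≤c/16 , ≤-refl
      total : ∀ M → (M ≡ 0 → t ℕ.≤ 1250) →
        + 1 / 64 * (fromℕ 4 * a + fromℕ 2 * b + c + fromℕ 16) ≡ + 1 / 16 * a + ½ * (+ 1 / 16 * b + ½ * Q₃ M)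
      total zero small = trans (cong (λ x → + 1 / 64 * (fromℕ 4 * a + fromℕ 2 * b + x + fromℕ 16)) (cong fromℕ (C≡16 (small refl))))
        (identity a b)
        where
        identity : ∀ a b → + 1 / 64 * (+ 4 / 1 * a + + 2 / 1 * b + + 16 / 1 + + 16 / 1) ≡ + 1 / 16 * a + ½ * (+ 1 / 16 * b + ½ * (+ 2 / 1))
        identity = solve-∀ ring
      total (suc M) _ = identity a b c
        where
        identity : ∀ a b c → + 1 / 64 * (+ 4 / 1 * a + + 2 / 1 * b + c + + 16 / 1)
          ≡ + 1 / 16 * a + ½ * (+ 1 / 16 * b + ½ * (+ 1 / 16 * c + ½ * (+ 2 / 1)))
        identity = solve-∀ ring

    -- As l ≥ n - j - 2, it suffices that j n + j + 2 < (Q + 1) n, where 64 (Q + 1) = L accounts for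
    -- 80 = 16 + 64. The certificate asserts this at t; it extends to n ≥ t because 64 j ≤ L.
    certified-bound : ∀ n p l → p ℕ.+ j ≡ n → t ℕ.≤ n → n ℕ.≤ l ℕ.+ j ℕ.+ 2 →
      fromℕ n * fromℕ n < fromℕ (p ℕ.* n ℕ.+ l) + fromℕ n * certifiedQ
    certified-bound n p l p+j≡n t≤n n≤ = <-by _ (0<-· (+ 1 / 64) (0<-gap (subst₂ _<_
        (trans (fromℕ-* 64 (n ℕ.* n)) (cong (fromℕ 64 *_) (fromℕ-* n n)))
        (trans (fromℕ-+ (64 ℕ.* (p ℕ.* n ℕ.+ l)) (n ℕ.* K)) (cong₂ _+_ (fromℕ-* 64 (p ℕ.* n ℕ.+ l)) (fromℕ-* n K)))
        (fromℕ-< (64 ℕ.* (n ℕ.* n)) (64 ℕ.* (p ℕ.* n ℕ.+ l) ℕ.+ n ℕ.* K) boundℕ))))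
      (identity (fromℕ n) (fromℕ (p ℕ.* n ℕ.+ l)) (fromℕ K))
      where
      K = 4 ℕ.* A ℕ.+ 2 ℕ.* B ℕ.+ C ℕ.+ 16
      L = 4 ℕ.* A ℕ.+ 2 ℕ.* B ℕ.+ C ℕ.+ 80
      identity : ∀ n l K → n * n + + 1 / 64 * (+ 64 / 1 * l + n * K - + 64 / 1 * (n * n)) ≡ l + n * (+ 1 / 64 * K)
      identity = solve-∀ ring
      d = n ℕ.∸ t
      t+d≡n : t ℕ.+ d ≡ n
      t+d≡n = ℕ.m+[n∸m]≡n t≤n
      64j≤L : 64 ℕ.* j ℕ.≤ L
      64j≤L = ℕ.<⇒≤ (ℕ.*-cancelʳ-< t (64 ℕ.* j) L (ℕ.≤-<-trans (begin
        64 ℕ.* j ℕ.* t                   ≡⟨ ℕ.*-assoc 64 j t ⟩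
        64 ℕ.* (j ℕ.* t)                 ≤⟨ ℕ.*-monoʳ-≤ 64 (ℕ.≤-trans (ℕ.m≤m+n (j ℕ.* t) j) (ℕ.m≤m+n _ 2)) ⟩
        64 ℕ.* (j ℕ.* t ℕ.+ j ℕ.+ 2)     ∎) exceeds))
        where open ℕ.≤-Reasoning
      exceedsₙ : 64 ℕ.* (j ℕ.* n ℕ.+ j ℕ.+ 2) ℕ.< L ℕ.* n
      exceedsₙ = subst (λ n → 64 ℕ.* (j ℕ.* n ℕ.+ j ℕ.+ 2) ℕ.< L ℕ.* n) t+d≡n (begin-strict
        64 ℕ.* (j ℕ.* (t ℕ.+ d) ℕ.+ j ℕ.+ 2)
          ≡⟨ solve 3 (λ j t d → con 64 :* (j :* (t :+ d) :+ j :+ con 2) := con 64 :* (j :* t :+ j :+ con 2) :+ con 64 :* j :* d) refl j t d ⟩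
        64 ℕ.* (j ℕ.* t ℕ.+ j ℕ.+ 2) ℕ.+ 64 ℕ.* j ℕ.* d  <⟨ ℕ.+-mono-<-≤ exceeds (ℕ.*-monoˡ-≤ d 64j≤L) ⟩
        L ℕ.* t ℕ.+ L ℕ.* d                               ≡⟨ ℕ.*-distribˡ-+ L t d ⟨
        L ℕ.* (t ℕ.+ d)                                   ∎)
        where open ℕ.≤-Reasoning
      boundℕ : 64 ℕ.* (n ℕ.* n) ℕ.< 64 ℕ.* (p ℕ.* n ℕ.+ l) ℕ.+ n ℕ.* K
      boundℕ = ℕ.+-cancelʳ-< (64 ℕ.* n) _ _ (begin-strict
        64 ℕ.* (n ℕ.* n) ℕ.+ 64 ℕ.* n                      ≡⟨ cong (λ x → 64 ℕ.* (x ℕ.* n) ℕ.+ 64 ℕ.* n) p+j≡n ⟨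
        64 ℕ.* ((p ℕ.+ j) ℕ.* n) ℕ.+ 64 ℕ.* n              ≤⟨ ℕ.+-monoʳ-≤ (64 ℕ.* ((p ℕ.+ j) ℕ.* n)) (ℕ.*-monoʳ-≤ 64 n≤) ⟩
        64 ℕ.* ((p ℕ.+ j) ℕ.* n) ℕ.+ 64 ℕ.* (l ℕ.+ j ℕ.+ 2)
          ≡⟨ solve 4 (λ p j n l → con 64 :* ((p :+ j) :* n) :+ con 64 :* (l :+ j :+ con 2)
               := con 64 :* (p :* n :+ l) :+ con 64 :* (j :* n :+ j :+ con 2)) refl p j n l ⟩
        64 ℕ.* (p ℕ.* n ℕ.+ l) ℕ.+ 64 ℕ.* (j ℕ.* n ℕ.+ j ℕ.+ 2)  <⟨ ℕ.+-monoʳ-< (64 ℕ.* (p ℕ.* n ℕ.+ l)) exceedsₙ ⟩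
        64 ℕ.* (p ℕ.* n ℕ.+ l) ℕ.+ L ℕ.* n
          ≡⟨ solve 3 (λ k x n → k :+ (x :+ con 80) :* n := k :+ n :* (x :+ con 16) :+ con 64 :* n) refl (64 ℕ.* (p ℕ.* n ℕ.+ l)) (4 ℕ.* A ℕ.+ 2 ℕ.* B ℕ.+ C) n ⟩
        64 ℕ.* (p ℕ.* n ℕ.+ l) ℕ.+ n ℕ.* K ℕ.+ 64 ℕ.* n    ∎)
        where open ℕ.≤-Reasoning

  LowerWitness : ℕ → ℕ → Set
  LowerWitness N n = ∃ λ Q → Below N (fromℕ n) Q × 0ℚ ≤ Q × fromℕ n * fromℕ n < fromℕ (lower n) + fromℕ n * Q

  module _ (n : ℕ) (3≤n : 3 ℕ.≤ n) where

    open Lower.Block (Lower.blocks n 3≤n) renaming (width to p)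

    private
      j = Lower.index-at n

    lower-witness-certified : ∀ M → (M ≡ 0 → n ℕ.≤ 1250) → j ℕ.< 400 → LowerWitness (2 ℕ.+ M) n
    lower-witness-certified M small j<400 =
      certifiedQ cert , Below-certifiedQ cert M n t≤n (λ M≡0 → ℕ.≤-trans t≤n (small M≡0)) , 0≤certifiedQ cert ,
      subst (λ v → fromℕ n * fromℕ n < fromℕ v + fromℕ n * certifiedQ cert) (sym value≡)
        (certified-bound cert n p (lower j) width+j≡n t≤n (lower-inactive 3≤n))
      where
      cert = lower-certificate j j<400
      t≤n : lower j ℕ.+ 3 ℕ.∸ j ℕ.≤ n
      t≤n = ℕ.m≤n+o⇒m∸n≤o (lower j ℕ.+ 3) j (subst (lower j ℕ.+ 3 ℕ.≤_) (ℕ.+-comm n j) (lower-active 3≤n))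

    400j≤2n : 400 ℕ.≤ j → 400 ℕ.* j ℕ.≤ 2 ℕ.* n
    400j≤2n 400≤j = ℕ.≤-trans (ℕ.*-monoˡ-≤ j 400≤j) (lower-index² 3≤n)

    -- The claim amounts to j n < l + n Qₙ. By l ≥ n - j - 2 and Qₙ ≥ j - 39/40 it remains to see
    -- that n/40 > j + 2, which follows from j² ≤ 2 n and j ≥ 400.
    lower-witness-step : ∀ N → 400 ℕ.≤ j → LowerWitness N j → LowerWitness (suc N) n
    lower-witness-step N 400≤j (Q , b , 0≤Q , j²<) = Qₙ , Below-Qₙ , 0≤Qₙ ,
      subst (λ v → fromℕ n * fromℕ n < fromℕ v + fromℕ n * Qₙ) (sym value≡)
        (subst₂ _<_ n² l+nQ (<-by _
          (+-mono-<-≤ (0<-· (+ 1 / 40) (0<-gap 40[x+2]<n)) (0≤-* (0≤fromℕ n) (0≤-gap x≤Qₙ) ⊕ 0≤-gap n≤))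
          (identity (fromℕ p) x (fromℕ n) l Qₙ)))
      where
      x l : ℚ
      x = fromℕ j
      l = fromℕ (lower j)
      open BelowStep N {x} {Q} {l} {fromℕ n} (fromℕ-≤ 400 j 400≤j) 0≤Q b (<⇒≤ j²<)
        (subst₂ _≤_ (fromℕ-+ (lower j) 3) (fromℕ-+ n j) (fromℕ-≤ (lower j ℕ.+ 3) (n ℕ.+ j) (lower-active 3≤n)))
      identity : ∀ p x n l Q → (p + x) * n + (+ 1 / 40 * (n - + 40 / 1 * (x + + 2 / 1)) + (n * (Q + + 39 / 40 - x) + (l + x + + 2 / 1 - n)))
        ≡ p * n + l + n * Q
      identity = solve-∀ ring
      n² : (fromℕ p + x) * fromℕ n ≡ fromℕ n * fromℕ n
      n² = cong (_* fromℕ n) (trans (sym (fromℕ-+ p j)) (cong fromℕ width+j≡n))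
      l+nQ : fromℕ p * fromℕ n + l + fromℕ n * Qₙ ≡ fromℕ (p ℕ.* n ℕ.+ lower j) + fromℕ n * Qₙ
      l+nQ = cong (λ y → y + fromℕ n * Qₙ) (sym (trans (fromℕ-+ (p ℕ.* n) (lower j)) (cong (λ y → y + l) (fromℕ-* p n))))
      n≤ : fromℕ n ≤ l + x + fromℕ 2
      n≤ = subst (fromℕ n ≤_) (trans (fromℕ-+ (lower j ℕ.+ j) 2) (cong (λ y → y + fromℕ 2) (fromℕ-+ (lower j) j)))
        (fromℕ-≤ n (lower j ℕ.+ j ℕ.+ 2) (lower-inactive 3≤n))
      40[j+2]<n : 40 ℕ.* (j ℕ.+ 2) ℕ.< n
      40[j+2]<n = ℕ.*-cancelˡ-< 2 (40 ℕ.* (j ℕ.+ 2)) n (ℕ.<-≤-trans (begin-strict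
        2 ℕ.* (40 ℕ.* (j ℕ.+ 2))        ≡⟨ solve 1 (λ j → con 2 :* (con 40 :* (j :+ con 2)) := con 80 :* j :+ con 160) refl j ⟩
        80 ℕ.* j ℕ.+ 160                <⟨ ℕ.+-monoʳ-< (80 ℕ.* j) (ℕ.m≤m+n 161 239) ⟩
        80 ℕ.* j ℕ.+ 400                ≤⟨ ℕ.+-monoʳ-≤ (80 ℕ.* j) 400≤j ⟩
        80 ℕ.* j ℕ.+ j                  ≡⟨ solve 1 (λ j → con 80 :* j :+ j := con 81 :* j) refl j ⟩
        81 ℕ.* j                        ≤⟨ ℕ.*-monoˡ-≤ j (ℕ.m≤m+n 81 319) ⟩
        400 ℕ.* j                       ∎) (400j≤2n 400≤j))
        where open ℕ.≤-Reasoning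
      40[x+2]<n : fromℕ 40 * (x + fromℕ 2) < fromℕ n
      40[x+2]<n = subst (_< fromℕ n) (trans (fromℕ-* 40 (j ℕ.+ 2)) (cong (fromℕ 40 *_) (fromℕ-+ j 2)))
        (fromℕ-< (40 ℕ.* (j ℕ.+ 2)) n 40[j+2]<n)

  5^2^ : ∀ m → 5 ℕ.^ (2 ℕ.^ suc m) ≡ 5 ℕ.^ (2 ℕ.^ m) ℕ.* 5 ℕ.^ (2 ℕ.^ m)
  5^2^ m = trans (cong (λ e → 5 ℕ.^ (2 ℕ.^ m ℕ.+ e)) (ℕ.+-identityʳ (2 ℕ.^ m))) (ℕ.^-distribˡ-+-* 5 (2 ℕ.^ m) (2 ℕ.^ m))

  -- The factor 2 gives the induction room: the index j may exceed √n.
  lower-witness : ∀ M n → 3 ℕ.≤ n → n ℕ.≤ 2 ℕ.* 5 ℕ.^ (2 ℕ.^ (2 ℕ.+ M)) → LowerWitness (2 ℕ.+ M) n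
  lower-witness M n 3≤n n≤ = cases M n≤ (j ℕ.<? 400)
    where
    j = Lower.index-at n
    cases : ∀ M → n ℕ.≤ 2 ℕ.* 5 ℕ.^ (2 ℕ.^ (2 ℕ.+ M)) → Dec (j ℕ.< 400) → LowerWitness (2 ℕ.+ M) n
    cases M n≤ (yes j<400) = lower-witness-certified n 3≤n M (λ { refl → n≤ }) j<400
    -- Impossible, as 160000 ≤ 400 j ≤ 2 n ≤ 2500.
    cases zero n≤ (no j≮400) = ⊥-elim (ℕ.<⇒≱ (ℕ.m≤m+n 2501 157499) (ℕ.≤-trans (ℕ.*-monoʳ-≤ 400 400≤j) (ℕ.≤-trans (400j≤2n n 3≤n 400≤j) (ℕ.*-monoʳ-≤ 2 n≤))))
      where 400≤j = ℕ.≮⇒≥ j≮400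
    cases (suc M) n≤ (no j≮400) = lower-witness-step n 3≤n (2 ℕ.+ M) 400≤j
        (lower-witness M j (ℕ.≤-trans (ℕ.m≤m+n 3 397) 400≤j) j≤2K)
      where
      400≤j = ℕ.≮⇒≥ j≮400
      K = 5 ℕ.^ (2 ℕ.^ (2 ℕ.+ M))
      j≤2K : j ℕ.≤ 2 ℕ.* K
      j≤2K = ℕ.≮⇒≥ λ 2K<j → ℕ.<⇒≱ (ℕ.*-mono-< 2K<j 2K<j) (begin
        j ℕ.* j                          ≤⟨ lower-index² 3≤n ⟩
        2 ℕ.* n                          ≤⟨ ℕ.*-monoʳ-≤ 2 n≤ ⟩
        2 ℕ.* (2 ℕ.* 5 ℕ.^ (2 ℕ.^ (3 ℕ.+ M))) ≡⟨ cong (λ x → 2 ℕ.* (2 ℕ.* x)) (5^2^ (2 ℕ.+ M)) ⟩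
        2 ℕ.* (2 ℕ.* (K ℕ.* K))          ≡⟨ solve 1 (λ k → con 2 :* (con 2 :* (k :* k)) := con 2 :* k :* (con 2 :* k)) refl K ⟩
        2 ℕ.* K ℕ.* (2 ℕ.* K)            ∎)
        where open ℕ.≤-Reasoning

  -- From nested square roots to the sum in g(n).

  ^ᵠ-+ : ∀ x a b → x ^ᵠ (a ℕ.+ b) ≡ x ^ᵠ a * x ^ᵠ b
  ^ᵠ-+ x zero    b = sym (*-identityˡ (x ^ᵠ b))
  ^ᵠ-+ x (suc a) b = trans (cong (x *_) (^ᵠ-+ x a b)) (sym (*-assoc x (x ^ᵠ a) (x ^ᵠ b)))

  ^ᵠ-* : ∀ x y a → (x * y) ^ᵠ a ≡ x ^ᵠ a * y ^ᵠ a
  ^ᵠ-* x y zero    = refl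
  ^ᵠ-* x y (suc a) = trans (cong (x * y *_) (^ᵠ-* x y a)) (identity x y (x ^ᵠ a) (y ^ᵠ a))
    where
    identity : ∀ x y a b → x * y * (a * b) ≡ x * a * (y * b)
    identity = solve-∀ ring

  fromℕ-^ : ∀ n a → fromℕ (n ℕ.^ a) ≡ fromℕ n ^ᵠ a
  fromℕ-^ n zero    = refl
  fromℕ-^ n (suc a) = trans (fromℕ-* n (n ℕ.^ a)) (cong (fromℕ n *_) (fromℕ-^ n a))

  0≤^ᵠ : ∀ {x} a → 0ℚ ≤ x → 0ℚ ≤ x ^ᵠ a
  0≤^ᵠ zero    0≤x = 0≤lit 1ℚ
  0≤^ᵠ (suc a) 0≤x = 0≤-* 0≤x (0≤^ᵠ a 0≤x)

  *-mono-≤ : ∀ {p q r s} → 0ℚ ≤ p → 0ℚ ≤ r → p ≤ q → r ≤ s → p * r ≤ q * s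
  *-mono-≤ {p} {q} {r} {s} 0≤p 0≤r p≤q r≤s = ≤-by _
    (0≤-* 0≤p (0≤-gap r≤s) ⊕ 0≤-* (≤-trans 0≤r r≤s) (0≤-gap p≤q)) (identity p q r s)
    where
    identity : ∀ p q r s → p * r + (p * (s - r) + s * (q - p)) ≡ q * s
    identity = solve-∀ ring

  1≤^ᵠ : ∀ {x} a → 1ℚ ≤ x → 1ℚ ≤ x ^ᵠ a
  1≤^ᵠ zero    1≤x = ≤-refl
  1≤^ᵠ (suc a) 1≤x = *-mono-≤ (0≤lit 1ℚ) (0≤lit 1ℚ) 1≤x (1≤^ᵠ a 1≤x)

  base≤^ᵠ : ∀ {x} a → 1 ℕ.≤ a → 1ℚ ≤ x → x ≤ x ^ᵠ a
  base≤^ᵠ {x} (suc a) _ 1≤x = subst (_≤ x ^ᵠ suc a) (*-identityʳ x)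
    (*-mono-≤ (≤-trans (0≤lit 1ℚ) 1≤x) (0≤lit 1ℚ) ≤-refl (1≤^ᵠ a 1≤x))

  0^ᵠ : ∀ a → 1 ℕ.≤ a → 0ℚ ^ᵠ a ≡ 0ℚ
  0^ᵠ (suc a) _ = *-zeroˡ (0ℚ ^ᵠ a)

  1≤2^ : ∀ j → 1 ℕ.≤ 2 ℕ.^ j
  1≤2^ j = ℕ.m^n>0 2 j

  ^ᵠ-2^suc : ∀ x j → x ^ᵠ (2 ℕ.^ suc j) ≡ x ^ᵠ (2 ℕ.^ j) * x ^ᵠ (2 ℕ.^ j)
  ^ᵠ-2^suc x j = trans (cong (λ e → x ^ᵠ (2 ℕ.^ j ℕ.+ e)) (ℕ.+-identityʳ (2 ℕ.^ j))) (^ᵠ-+ x (2 ℕ.^ j) (2 ℕ.^ j))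

  weighted : (ℕ → ℚ) → ℕ → ℚ
  weighted ρ j = ρ j * half^ (j ℕ.∸ 1)

  sum-shift : ∀ N ρ → sum1to (suc N) (weighted ρ) ≡ ρ 1 + ½ * sum1to N (weighted (λ j → ρ (suc j)))
  sum-shift zero    ρ = identity (ρ 1)
    where
    identity : ∀ x → 0ℚ + x * 1ℚ ≡ x + ½ * 0ℚ
    identity = solve-∀ ring
  sum-shift (suc N) ρ = trans (cong (λ s → s + ρ (2 ℕ.+ N) * half^ (suc N)) (sum-shift N ρ))
    (identity (ρ 1) (sum1to N (weighted (λ j → ρ (suc j)))) (ρ (2 ℕ.+ N)) (half^ N))
    where
    identity : ∀ a s r h → a + ½ * s + r * (½ * h) ≡ a + ½ * (s + r * h)
    identity = solve-∀ ring

  -- The last term is Q₀ = 2 after N halvings. It is also the correction inside `gRest`, so that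
  -- g(n) = n² + 2 n - n Q_N(n) holds exactly.
  total : ℕ → (ℕ → ℚ) → ℚ
  total N ρ = sum1to N (weighted ρ) + fromℕ 2 * half^ N

  total-suc : ∀ N ρ → total (suc N) ρ ≡ ρ 1 + ½ * total N (λ j → ρ (suc j))
  total-suc N ρ = trans (cong (λ s → s + fromℕ 2 * half^ (suc N)) (sum-shift N ρ))
    (identity (ρ 1) (sum1to N (weighted (λ j → ρ (suc j)))) (half^ N))
    where
    identity : ∀ r s h → r + ½ * s + + 2 / 1 * (½ * h) ≡ r + ½ * (s + + 2 / 1 * h)
    identity = solve-∀ ring

  -- If r is a square root of z, the 2^j-th roots of r are the 2^(j+1)-th roots of z, so a family
  -- for r is shifted by one.
  prepend : ℚ → (ℕ → ℚ) → ℕ → ℚ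
  prepend z ρ zero    = z
  prepend z ρ (suc j) = ρ j

  total-prepend : ∀ N {z r} ρ → ρ 0 ≡ r → total (suc N) (prepend z ρ) ≡ r + ½ * total N ρ
  total-prepend N {z} ρ ρ0≡r = trans (total-suc N (prepend z ρ)) (cong (λ x → x + ½ * total N ρ) ρ0≡r)

  sum-scale : ∀ N c ρ → sum1to N (weighted (λ j → c * ρ j)) ≡ c * sum1to N (weighted ρ)
  sum-scale zero    c ρ = sym (*-zeroʳ c)
  sum-scale (suc N) c ρ = trans (cong (λ s → s + c * ρ (suc N) * half^ N) (sum-scale N c ρ))
    (identity c (sum1to N (weighted ρ)) (ρ (suc N)) (half^ N))
    where
    identity : ∀ c s r h → c * s + c * r * h ≡ c * (s + r * h)
    identity = solve-∀ ring

  Above⇒roots : ∀ N {z Q} → 0ℚ ≤ z → Above N z Q → Σ (ℕ → ℚ) λ ρ → ρ 0 ≡ z ×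
    (∀ j → 0ℚ ≤ ρ j × z ≤ ρ j ^ᵠ (2 ℕ.^ j)) × total N ρ ≤ Q
  Above⇒roots zero {z} {Q} 0≤z 2≤Q = ρ , refl , root , 2≤Q
    where
    ρ : ℕ → ℚ
    ρ zero    = z
    -- A bound is demanded at every j, also beyond N. Adding 1 makes the powers increase even when z
    -- < 1.
    ρ (suc j) = z + 1ℚ
    root : ∀ j → 0ℚ ≤ ρ j × z ≤ ρ j ^ᵠ (2 ℕ.^ j)
    root zero    = 0≤z , ≤-reflexive (sym (*-identityʳ z))
    root (suc j) = 0≤z ⊕ 0≤lit 1ℚ , ≤-trans (≤-by 1ℚ (0≤lit 1ℚ) refl)
      (base≤^ᵠ (2 ℕ.^ suc j) (1≤2^ (suc j)) (≤-by z 0≤z (+-comm 1ℚ z)))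
  Above⇒roots (suc N) {z} {Q} 0≤z (r , Q′ , 0≤r , z≤r² , a , le) =
    let ρ , ρ0≡r , root , total≤ = Above⇒roots N 0≤r a in
    prepend z ρ , refl , prepend-root root ,
    ≤-trans (≤-reflexive (total-prepend N ρ ρ0≡r)) (≤-trans (+-monoʳ-≤ r (*-monoˡ-≤-nonNeg ½ total≤)) le)
    where
    prepend-root : ∀ {ρ} → (∀ j → 0ℚ ≤ ρ j × r ≤ ρ j ^ᵠ (2 ℕ.^ j)) →
      ∀ j → 0ℚ ≤ prepend z ρ j × z ≤ prepend z ρ j ^ᵠ (2 ℕ.^ j)
    prepend-root     root zero    = 0≤z , ≤-reflexive (sym (*-identityʳ z))
    prepend-root {ρ} root (suc j) = proj₁ (root j) , subst (z ≤_) (sym (^ᵠ-2^suc (ρ j) j))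
      (≤-trans z≤r² (*-mono-≤ 0≤r 0≤r (proj₂ (root j)) (proj₂ (root j))))

  Below⇒roots : ∀ N {z Q} → 0ℚ ≤ z → Below N z Q → Σ (ℕ → ℚ) λ ρ → ρ 0 ≡ z ×
    (∀ j → 0ℚ ≤ ρ j × ρ j ^ᵠ (2 ℕ.^ j) ≤ z) × Q ≤ total N ρ
  Below⇒roots zero {z} {Q} 0≤z Q≤2 = ρ , refl , root , Q≤2
    where
    ρ : ℕ → ℚ
    ρ zero    = z
    ρ (suc j) = 0ℚ
    root : ∀ j → 0ℚ ≤ ρ j × ρ j ^ᵠ (2 ℕ.^ j) ≤ z
    root zero    = 0≤z , ≤-reflexive (*-identityʳ z)
    root (suc j) = ≤-refl , subst (_≤ z) (sym (0^ᵠ (2 ℕ.^ suc j) (1≤2^ (suc j)))) 0≤z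
  Below⇒roots (suc N) {z} {Q} 0≤z (r , Q′ , 0≤r , r²≤z , b , le) =
    let ρ , ρ0≡r , root , ≤total = Below⇒roots N 0≤r b in
    prepend z ρ , refl , prepend-root root ,
    ≤-trans le (≤-trans (+-monoʳ-≤ r (*-monoˡ-≤-nonNeg ½ ≤total)) (≤-reflexive (sym (total-prepend N ρ ρ0≡r))))
    where
    prepend-root : ∀ {ρ} → (∀ j → 0ℚ ≤ ρ j × ρ j ^ᵠ (2 ℕ.^ j) ≤ r) →
      ∀ j → 0ℚ ≤ prepend z ρ j × prepend z ρ j ^ᵠ (2 ℕ.^ j) ≤ z
    prepend-root     root zero    = 0≤z , ≤-reflexive (*-identityʳ z)
    prepend-root {ρ} root (suc j) = proj₁ (root j) , subst (_≤ z) (sym (^ᵠ-2^suc (ρ j) j))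
      (≤-trans (*-mono-≤ 0≤s 0≤s (proj₂ (root j)) (proj₂ (root j))) r²≤z)
      where 0≤s = 0≤^ᵠ (2 ℕ.^ j) (proj₁ (root j))

  scaled-root : ∀ n j x → fromℕ (n ℕ.^ (2 ℕ.^ j)) * x ^ᵠ (2 ℕ.^ j) ≡ (fromℕ n * x) ^ᵠ (2 ℕ.^ j)
  scaled-root n j x = trans (cong (_* x ^ᵠ (2 ℕ.^ j)) (fromℕ-^ n (2 ℕ.^ j))) (sym (^ᵠ-* (fromℕ n) x (2 ℕ.^ j)))

  fromℕ-^suc : ∀ n j → fromℕ (n ℕ.^ (2 ℕ.^ j)) * fromℕ n ≡ fromℕ (n ℕ.^ (2 ℕ.^ j ℕ.+ 1))
  fromℕ-^suc n j = trans (sym (fromℕ-* (n ℕ.^ (2 ℕ.^ j)) n)) (cong fromℕ (sym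
    (trans (ℕ.^-distribˡ-+-* n (2 ℕ.^ j) 1) (cong (n ℕ.^ (2 ℕ.^ j) ℕ.*_) (ℕ.*-identityʳ n)))))

  -- Since n^(1 + 1/2^j) = n · n^(1/2^j), the approximations in the sum are n times those of the
  -- roots of n.
  sumLT : ∀ n N b Q → Above N (fromℕ n) Q → fromℕ b + fromℕ n * Q < fromℕ n * fromℕ n + fromℕ 4 * fromℕ n →
    SumLT n N (gRest n N - fromℕ b + fromℕ (2 ℕ.* n))
  sumLT n N b Q a lt =
    let ρ , _ , root , total≤ = Above⇒roots N (0≤fromℕ n) a in
    (λ j → fromℕ n * ρ j) ,
    (λ j → 0≤-* (0≤fromℕ n) (proj₁ (root j)) ,
      subst₂ _≤_ (fromℕ-^suc n j) (scaled-root n j (ρ j))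
        (*-monoˡ-≤-nonNeg (fromℕ (n ℕ.^ (2 ℕ.^ j))) {{nonNegative (0≤fromℕ (n ℕ.^ (2 ℕ.^ j)))}} (proj₂ (root j)))) ,
    subst₂ _<_ (sym (sum-scale N (fromℕ n) ρ)) (cong₂ (λ x y → x + (fromℕ 2 - fromℕ 2 * half^ N) * fromℕ n - fromℕ b + y) (sym (fromℕ-* n n)) (sym (fromℕ-* 2 n)))
      (<-by _ (+-mono-<-≤ (0<-gap lt) (0≤-* (0≤fromℕ n) (0≤-gap total≤)))
        (identity (fromℕ n) (fromℕ b) Q (sum1to N (weighted ρ)) (half^ N)))
    where
    identity : ∀ n b Q s h → n * s + (n * n + + 4 / 1 * n - (b + n * Q) + n * (Q - (s + + 2 / 1 * h)))
      ≡ n * n + (+ 2 / 1 - + 2 / 1 * h) * n - b + + 2 / 1 * n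
    identity = solve-∀ ring

  sumGT : ∀ n N b Q → Below N (fromℕ n) Q → fromℕ n * fromℕ n < fromℕ b + fromℕ n * Q →
    SumGT n N (gRest n N - fromℕ b - fromℕ (2 ℕ.* n))
  sumGT n N b Q below lt =
    let ρ , _ , root , ≤total = Below⇒roots N (0≤fromℕ n) below in
    (λ j → fromℕ n * ρ j) ,
    (λ j → 0≤-* (0≤fromℕ n) (proj₁ (root j)) ,
      subst₂ _≤_ (scaled-root n j (ρ j)) (fromℕ-^suc n j)
        (*-monoˡ-≤-nonNeg (fromℕ (n ℕ.^ (2 ℕ.^ j))) {{nonNegative (0≤fromℕ (n ℕ.^ (2 ℕ.^ j)))}} (proj₂ (root j)))) ,
    subst₂ _<_ (cong₂ (λ x y → x + (fromℕ 2 - fromℕ 2 * half^ N) * fromℕ n - fromℕ b - y) (sym (fromℕ-* n n)) (sym (fromℕ-* 2 n))) (sym (sum-scale N (fromℕ n) ρ))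
      (<-by _ (+-mono-<-≤ (0<-gap lt) (0≤-* (0≤fromℕ n) (0≤-gap ≤total)))
        (identity (fromℕ n) (fromℕ b) Q (sum1to N (weighted ρ)) (half^ N)))
    where
    identity : ∀ n b Q s h → n * n + (+ 2 / 1 - + 2 / 1 * h) * n - b - + 2 / 1 * n
      + (b + n * Q - n * n + n * (s + + 2 / 1 * h - Q)) ≡ n * s
    identity = solve-∀ ring

  -- The remaining small cases and the two bounds on b(n).

  lower-witness-small : ∀ n → 3 ℕ.≤ n → n ℕ.< 25 → LowerWitness 1 n
  lower-witness-small n 3≤n n<25 =
    let r , r²≤n , lt = small-certificate n 3≤n n<25 in
    fromℕ r + 1ℚ ,
    (fromℕ r , fromℕ 2 , 0≤fromℕ r , subst (_≤ fromℕ n) (fromℕ-* r r) (fromℕ-≤ (r ℕ.* r) n r²≤n) , ≤-refl , ≤-refl) ,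
    0≤fromℕ r ⊕ 0≤lit 1ℚ ,
    subst₂ _<_ (fromℕ-* n n)
      (trans (fromℕ-+ (lower n) (n ℕ.* (r ℕ.+ 1))) (cong (λ x → fromℕ (lower n) + x) (trans (fromℕ-* n (r ℕ.+ 1)) (cong (fromℕ n *_) (fromℕ-+ r 1)))))
      (fromℕ-< (n ℕ.* n) (lower n ℕ.+ n ℕ.* (r ℕ.+ 1)) lt)

  lower-witness-IsN : ∀ n N → 3 ℕ.≤ n → IsN n N → LowerWitness N n
  lower-witness-IsN n zero 3≤n n<5 = tiny n 3≤n n<5
    where
    tiny : ∀ n → 3 ℕ.≤ n → n ℕ.< 5 → LowerWitness 0 n
    tiny 1 (ℕ.s≤s ()) _
    tiny 2 (ℕ.s≤s (ℕ.s≤s ())) _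
    -- Here 13 = lower 3 + 3 · 2 with `lower 3` equal to 7, and in the next case 21 = lower 4 + 4 ·
    -- 2 with `lower 4` equal to 13.
    tiny 3 _ _ = fromℕ 2 , ≤-refl , 0≤fromℕ 2 , fromℕ-< 9 13 (ℕ.m≤m+n 10 3)
    tiny 4 _ _ = fromℕ 2 , ≤-refl , 0≤fromℕ 2 , fromℕ-< 16 21 (ℕ.m≤m+n 17 4)
    tiny (suc (suc (suc (suc (suc _))))) _ (ℕ.s≤s (ℕ.s≤s (ℕ.s≤s (ℕ.s≤s (ℕ.s≤s ())))))
  lower-witness-IsN n (suc zero)    3≤n (_ , n<25) = lower-witness-small n 3≤n n<25
  lower-witness-IsN n (suc (suc M)) 3≤n (_ , n<) = lower-witness M n 3≤n
    (ℕ.≤-trans (ℕ.<⇒≤ n<) (ℕ.m≤m+n (5 ℕ.^ (2 ℕ.^ (2 ℕ.+ M))) _))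

  module _ {n b} (3≤n : 3 ℕ.≤ n) (isB : IsB n b) where

    private
      1≤n : 1 ℕ.≤ n
      1≤n = ℕ.≤-trans (ℕ.m≤m+n 1 2) 3≤n

    lower≤b : lower n ℕ.≤ b
    lower≤b = ℕ.≮⇒≥ λ b<l → proj₂ isB λ k n≤k k≤b+1 → interval⊆W n 1≤n k n≤k (ℕ.≤-trans k≤b+1 b<l)

    b<upper : b ℕ.< upper n
    b<upper = ℕ.≰⇒> λ u≤b → avoided (proj₁ isB (upper n) n≤u u≤b)
      where
      open UpperBounds (upper-bounds n 1≤n)
      n≤u : n ℕ.≤ upper n
      n≤u = ℕ.s≤s⁻¹ (ℕ.≤-trans (ℕ.+-mono-≤ 1≤n (ℕ.m≤m+n n (n ℕ.+ 0))) triple)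

  g-2n<b : ∀ n b N → 3 ℕ.≤ n → IsB n b → IsN n N → SumGT n N (gRest n N - fromℕ b - fromℕ (2 ℕ.* n))
  g-2n<b n b N 3≤n isB isN =
    let Q , below , _ , lt = lower-witness-IsN n N 3≤n isN in
    sumGT n N b Q below (<-≤-trans lt (+-monoˡ-≤ (fromℕ n * Q) (fromℕ-≤ (lower n) b (lower≤b 3≤n isB))))

  b<g+2n : ∀ n b N → 3 ℕ.≤ n → IsB n b → SumLT n N (gRest n N - fromℕ b + fromℕ (2 ℕ.* n))
  b<g+2n n b N 3≤n isB =
    let Q , above , le = upper-witness n 3≤n N in
    sumLT n N b Q above (<-≤-trans (+-monoˡ-< (fromℕ n * Q) (fromℕ-< b (upper n) (b<upper 3≤n isB))) le)

open import Data.Nat using (ℕ; _≤_)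
open import Data.Product using (_,_)

theorem1p5 : ∀ (n b N : ℕ) → 3 ≤ n → IsB n b → IsN n N → AbsDiffLt2n n N b
theorem1p5 n b N 3≤n isB isN = Estimates.g-2n<b n b N 3≤n isB isN , Estimates.b<g+2n n b N 3≤n isB
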